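{- Let $G$ be a finite abelian group of order $9p^{4s}$, where $p$ is a prime with $p\equiv 1\pmod 4$ and $s$ is an odd positive integer. Then there does not exist a $(9p^{4s},\ r(3p^{2s}+1),\ -3p^{2s}+r^2+3r,\ r^2+r)$-partial difference set in $G$ when $r=(3p^{2s}-3)/4$ or $r=(3p^{2s}+5)/4$.
   Context: Let $G$ be a finite abelian group of order $v$ and $D\subseteq G$ with $|D|=k$. $D$ is a $(v,k,\lambda,\mu)$-partial difference set in $G$ if the expressions $gh^{ -1}$ with $g,h\in D$, $g\neq h$, represent each non-identity element of $D$ exactly $\lambda$ times and each non-identity element of $G$ not in $D$ exactly $\mu$ times. -}

module Defs where

open import Data.Nat using (ℕ)
open import Data.Fin using (Fin; _≟_)
open import Data.Fin.Subset using (Subset; _∈_; _∉_; ∣_∣)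
open import Data.Fin.Subset.Properties using (_∈?_)
open import Data.List using (List; length; filter; allFin; cartesianProduct)
open import Data.Product using (_×_; _,_)
open import Data.Integer using (ℤ; +_)
open import Relation.Binary.PropositionalEquality using (_≡_)
open import Relation.Nullary using (¬_)
open import Relation.Nullary.Decidable using (_×-dec_; ¬?)
open import Algebra.Structures using (IsAbelianGroup)

-- A finite abelian group of order v, represented (up to isomorphism) by
-- an abelian group structure on Fin v with propositional equality.
record FinAbelianGroup (v : ℕ) : Set where
  field
    _∙_ : Fin v → Fin v → Fin v
    ε   : Fin v
    _⁻¹ : Fin v → Fin v
    isAbelianGroup : IsAbelianGroup _≡_ _∙_ ε _⁻¹

repCount : ∀ {v} → FinAbelianGroup v → Subset v → Fin v → ℕ
repCount {v} G D x =
  length (filter (λ { (g , h) → (g ∈? D) ×-dec ((h ∈? D) ×-dec (¬? (g ≟ h) ×-dec ((g ∙ (h ⁻¹)) ≟ x))) })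
                 (cartesianProduct (allFin v) (allFin v)))
  where open FinAbelianGroup G

-- D is a (v , k , λ , μ)-partial difference set in G (λ , μ integers, as the
-- parameters are given by integer expressions).
IsPDS : ∀ {v} → FinAbelianGroup v → Subset v → ℕ → ℤ → ℤ → Set
IsPDS {v} G D k lam mu =
  ∣ D ∣ ≡ k
  × (∀ x → ¬ (x ≡ ε) → x ∈ D → + repCount G D x ≡ lam)
  × (∀ x → ¬ (x ≡ ε) → x ∉ D → + repCount G D x ≡ mu)
  where open FinAbelianGroup G

{-# OPTIONS --safe #-}

-- Write n = 3 p ^ (2 s) and, in the group ring ℤ[G], A = D − r · 1. The parameters say that D = D⁻¹,
-- that 1 ∉ D, and that A² = − n A + (r² + r) G.
--
-- For a prime t, A ^ t is congruent modulo t to the image of A under x ↦ x ^ t, while the quadratic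
-- relation writes A ^ t as a combination of A and G. For t ∤ 3 p this shows that D is invariant
-- under x ↦ x ^ t, hence under all exponents coprime to |G|; for t = 3 it gives |D ∩ T| ≡ r (mod 3),
-- where T is the Sylow 3-subgroup. The p − 1 exponents that are 1 modulo 9 and Teichmüller units
-- modulo p ^ (4 s) act freely off T, so modulo p − 1 only D ∩ T contributes to |D| and to the
-- number of elements of D in each coset of the Sylow p-subgroup.
--
-- Hence |D ∩ T| ≡ |D| ≡ 0 (mod 4), and as |T| = 9 this leaves D ∩ T = ∅ when r ≡ 0 (mod 3), and
-- D ∩ T = T ∖ {1} when r ≡ 2 (mod 3). Put r′ = r, respectively r′ = r + 1. Projecting the quadratic
-- relation to ℤ[T] and reducing modulo p − 1 gives r′ (r′ − n) ≡ 0 (mod p − 1). But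
-- p ^ (2 s) − 1 is p − 1 times twice an odd number because s is odd, so one of r′, r′ − n is an odd
-- multiple of (p − 1) / 2 and the other one is odd.

module Submission where

open import Defs
open import Algebra.Bundles using (AbelianGroup; CommutativeSemiring)
import Algebra.Construct.Pointwise as Pointwise
open import Algebra.Structures using (IsAbelianGroup)
open import Data.Bool using (true; false)
open import Data.Fin using (Fin; _≟_; toℕ; fromℕ; fromℕ<; inject₁) renaming (zero to fzero; suc to fsuc)
open import Data.Fin.Permutation using (permutation)
open import Data.Fin.Properties using (any?; toℕ<n; toℕ-injective; toℕ-fromℕ; toℕ-fromℕ<; toℕ-inject₁) renaming (suc-injective to fsuc-injective)
open import Data.Fin.Subset using (Subset; _∈_; _∉_; ∣_∣)
open import Data.Fin.Subset.Properties using (_∈?_; drop-there)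
open import Data.Integer using (ℤ; +_; -[1+_]; -_; 0ℤ; 1ℤ) renaming (_+_ to _+ᶻ_; _*_ to _*ᶻ_; _-_ to _-ᶻ_)
import Data.Integer as ℤ
import Data.Integer.Properties as ℤₚ
import Data.Integer.Tactic.RingSolver as ℤ-Solver
open import Data.List using (List; []; _∷_; _++_; length; filter; allFin; cartesianProduct; map; tabulate)
open import Data.List.Membership.Propositional.Properties using (∈-filter⁺; ∈-allFin)
open import Data.List.Properties using (length-++; filter-++; map-tabulate)
open import Data.List.Relation.Unary.All using (All; []; _∷_)
open import Data.Nat using (ℕ; zero; suc; _+_; _*_; _^_; _%_; _/_; _∸_; _≤_; _<_; NonZero; ≢-nonZero; z≤n; s≤s; z<s; s<s)
open import Data.Nat.Combinatorics using (_C_; nCn≡1; nC1≡n; nCk≡nC[n∸k]; nCk+nC[k+1]≡[n+1]C[k+1]; k>n⇒nCk≡0)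
open import Data.Nat.Coprimality using (Coprime; coprime-divisor; coprime-Bézout)
import Data.Nat.Coprimality as Coprimality
import Data.Nat.Divisibility as ℕ∣
open import Data.Nat.DivMod using (m≡m%n+[m/n]*n; m%n<n)
open import Data.Nat.GCD using (module Bézout)
open import Data.Nat.ListAction using (product)
open import Data.Nat.Primality using (Prime; prime?; ¬prime[0]; ¬prime[1]; euclidsLemma; prime⇒irreducible)
open import Data.Nat.Primality.Factorisation using (factorise; PrimeFactorisation)
import Data.Nat.Properties as ℕₚ
import Data.Nat.Tactic.RingSolver as ℕ-Solver
open import Data.Product using (_×_; _,_; proj₁; proj₂; ∃-syntax)
open import Data.Sum using (_⊎_; inj₁; inj₂)
open import Data.Unit using (tt)
open import Data.Vec using ([]; _∷_; there)
open import Relation.Binary.PropositionalEquality using (_≡_; _≢_; refl; sym; trans; cong; cong₂; subst; module ≡-Reasoning)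
open import Relation.Nullary using (¬_; Dec; yes; no; contradiction)
open import Relation.Nullary.Decidable using (_×-dec_; ¬?; from-yes; from-no)
open import Relation.Unary using (Decidable)

-- Once A² lies in the span of A and G, every power of A does, so the quadratic relation replaces
-- character theory throughout. The obstacle to the multiplier argument is a prime t dividing |G|,
-- where x ↦ xᵗ is not injective. For t = 3 a count survives: n and the coefficient sum r n of A are
-- divisible by 3, so A³ vanishes modulo 3. That count suffices because the multiples of 4 up to 8,
-- namely 0, 4 and 8, have different residues modulo 3. Teichmüller units are taken as exponents
-- because, modulo p ^ (4 s), they form a group of order p - 1 in which the difference of two
-- distinct members is again a unit; this difference makes the action free off T. In both cases the
-- indicator of D on T is α (T - 1) with α = 0 or 1. Modulo p - 1 the element A therefore projects
-- to α T - r′ · 1 with r′ = r + α, and its square differs from a multiple of T by r′² · 1.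
-- Comparing the coefficient of 1 with that of another element of T yields r′² ≡ n r′.

private variable
  ℓ m n : ℕ
  a b c a′ b′ : ℤ
  P P′ X Y : Set

-- Binomial coefficients and the Frobenius congruence in commutative semirings.

nC0≡1 : ∀ n → n C 0 ≡ 1
nC0≡1 n = trans (nCk≡nC[n∸k] {n = n} z≤n) (nCn≡1 n)

absorption : ∀ n k → suc k * (suc n C suc k) ≡ suc n * (n C k)
absorption n zero = trans (cong (1 *_) (nC1≡n (suc n)))
  (trans (ℕₚ.*-comm 1 (suc n)) (cong (suc n *_) (sym (nC0≡1 n))))
absorption zero (suc k) = trans (cong (suc (suc k) *_) (k>n⇒nCk≡0 {1} {suc (suc k)} (s<s z<s)))
  (trans (ℕₚ.*-zeroʳ (suc (suc k))) (sym (cong (1 *_) (k>n⇒nCk≡0 {0} {suc k} z<s))))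
absorption (suc n) (suc k) = begin
  suc (suc k) * (suc (suc n) C suc (suc k))
    ≡⟨ cong (suc (suc k) *_) (sym (nCk+nC[k+1]≡[n+1]C[k+1] (suc n) (suc k))) ⟩
  suc (suc k) * (suc n C suc k + suc n C suc (suc k))
    ≡⟨ split k (suc n C suc k) (suc n C suc (suc k)) ⟩
  (suc n C suc k) + (suc k * (suc n C suc k) + suc (suc k) * (suc n C suc (suc k)))
    ≡⟨ cong₂ (λ a b → (suc n C suc k) + (a + b)) (absorption n k) (absorption n (suc k)) ⟩
  (suc n C suc k) + (suc n * (n C k) + suc n * (n C suc k))
    ≡⟨ cong (λ a → (suc n C suc k) + a) (sym (ℕₚ.*-distribˡ-+ (suc n) (n C k) (n C suc k))) ⟩
  (suc n C suc k) + suc n * (n C k + n C suc k)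
    ≡⟨ cong (λ a → (suc n C suc k) + suc n * a) (nCk+nC[k+1]≡[n+1]C[k+1] n k) ⟩
  suc (suc n) * (suc n C suc k) ∎
  where
  open ≡-Reasoning
  split : ∀ k a b → suc (suc k) * (a + b) ≡ a + (suc k * a + suc (suc k) * b)
  split = ℕ-Solver.solve-∀

-- By `absorption` the prime divides `suc k` times the binomial coefficient, and `suc k` lies
-- strictly between 0 and the prime.
prime∣binomial : ∀ {n} → Prime (suc n) → ∀ {k} → k < n → suc n ℕ∣.∣ (suc n C suc k)
prime∣binomial {n} pr {k} k<n with euclidsLemma (suc k) (suc n C suc k) pr
    (ℕ∣.divides (n C k) (trans (absorption n k) (ℕₚ.*-comm (suc n) (n C k))))
... | inj₁ d = contradiction (ℕ∣.∣⇒≤ d) (ℕₚ.<⇒≱ (s<s k<n))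
... | inj₂ d = d

module Frobenius {c ℓ} (S : CommutativeSemiring c ℓ) where
  open CommutativeSemiring S
    renaming (_+_ to _⊕_; _*_ to _⊗_; refl to ≈-refl; sym to ≈-sym; trans to ≈-trans)
  open import Algebra.Properties.Semiring.Sum semiring
  open import Algebra.Properties.CommutativeMonoid.Mult +-commutativeMonoid
    renaming (_×_ to _·_)
  open import Algebra.Properties.Semiring.Exp semiring
    using () renaming (_^_ to _^ˢ_)
  import Algebra.Properties.CommutativeSemiring.Binomial S as Binomial
  open import Relation.Binary.Reasoning.Setoid setoid

  sum-× : ∀ {n} t (f : Fin n → Carrier) → sum (λ i → t · f i) ≈ t · sum f
  sum-× {zero}  t f = ≈-sym (lemma t)
    where
    lemma : ∀ t → t · 0# ≈ 0#
    lemma zero    = ≈-refl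
    lemma (suc t) = ≈-trans (+-identityˡ _) (lemma t)
  sum-× {suc n} t f = ≈-trans (+-congˡ (sum-× t (λ i → f (fsuc i)))) (≈-sym (×-distrib-+ _ _ t))

  -- Only the two end terms of the binomial expansion have a coefficient not divisible by t. Working
  -- in a semiring with an explicit witness `z` lets one statement serve both for ℤ, where it gives
  -- Fermat's theorem, and for the group ring.
  frobenius-+ : ∀ {t} → Prime t → ∀ x y → ∃[ z ] (x ⊕ y) ^ˢ t ≈ (x ^ˢ t ⊕ y ^ˢ t) ⊕ t · z
  frobenius-+ {zero}  pr = contradiction pr ¬prime[0]
  frobenius-+ {suc n} pr x y = sum quot , (begin
    (x ⊕ y) ^ˢ suc n
      ≈⟨ Binomial.theorem (suc n) x y ⟩
    term fzero ⊕ sum (λ i → term (fsuc i))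
      ≈⟨ +-congˡ (sum-init-last (λ i → term (fsuc i))) ⟩
    term fzero ⊕ (sum (λ i → term (fsuc (inject₁ i))) ⊕ term (fsuc (fromℕ n)))
      ≈⟨ +-cong first (+-cong (≈-trans (sum-cong-≋ middle) (sum-× (suc n) quot)) last′) ⟩
    y ^ˢ suc n ⊕ (suc n · sum quot ⊕ x ^ˢ suc n)
      ≈⟨ +-congˡ (+-comm _ _) ⟩
    y ^ˢ suc n ⊕ (x ^ˢ suc n ⊕ suc n · sum quot)
      ≈⟨ ≈-sym (+-assoc _ _ _) ⟩
    (y ^ˢ suc n ⊕ x ^ˢ suc n) ⊕ suc n · sum quot
      ≈⟨ +-congʳ (+-comm _ _) ⟩
    (x ^ˢ suc n ⊕ y ^ˢ suc n) ⊕ suc n · sum quot ∎)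
    where
    term : Fin (suc (suc n)) → Carrier
    term = Binomial.binomialTerm x y (suc n)

    divisible : (i : Fin n) → suc n ℕ∣.∣ (suc n C suc (toℕ i))
    divisible i = prime∣binomial pr (toℕ<n i)

    quot : Fin n → Carrier
    quot i = ℕ∣.quotient (divisible i) · (x ^ˢ suc (toℕ i) ⊗ y ^ˢ (n ∸ toℕ i))

    first : term fzero ≈ y ^ˢ suc n
    first = begin
      (suc n C 0) · (1# ⊗ y ^ˢ suc n) ≈⟨ ×-congˡ (nC0≡1 (suc n)) ⟩
      1 · (1# ⊗ y ^ˢ suc n)           ≈⟨ ×-homo-1 _ ⟩
      1# ⊗ y ^ˢ suc n                 ≈⟨ *-identityˡ _ ⟩
      y ^ˢ suc n                      ∎

    last′ : term (fsuc (fromℕ n)) ≈ x ^ˢ suc n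
    last′ = begin
      (suc n C suc (toℕ (fromℕ n))) · (x ^ˢ suc (toℕ (fromℕ n)) ⊗ y ^ˢ (n ∸ toℕ (fromℕ n)))
        ≡⟨ cong (λ m → (suc n C suc m) · (x ^ˢ suc m ⊗ y ^ˢ (n ∸ m))) (toℕ-fromℕ n) ⟩
      (suc n C suc n) · (x ^ˢ suc n ⊗ y ^ˢ (n ∸ n))
        ≡⟨ cong₂ (λ a b → a · (x ^ˢ suc n ⊗ y ^ˢ b)) (nCn≡1 (suc n)) (ℕₚ.n∸n≡0 n) ⟩
      1 · (x ^ˢ suc n ⊗ 1#)  ≈⟨ ×-homo-1 _ ⟩
      x ^ˢ suc n ⊗ 1#        ≈⟨ *-identityʳ _ ⟩
      x ^ˢ suc n             ∎

    middle : ∀ i → term (fsuc (inject₁ i)) ≈ suc n · quot i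
    middle i = begin
      (suc n C suc (toℕ (inject₁ i))) · (x ^ˢ suc (toℕ (inject₁ i)) ⊗ y ^ˢ (n ∸ toℕ (inject₁ i)))
        ≡⟨ cong (λ m → (suc n C suc m) · (x ^ˢ suc m ⊗ y ^ˢ (n ∸ m))) (toℕ-inject₁ i) ⟩
      (suc n C suc (toℕ i)) · (x ^ˢ suc (toℕ i) ⊗ y ^ˢ (n ∸ toℕ i))
        ≡⟨ cong (_· (x ^ˢ suc (toℕ i) ⊗ y ^ˢ (n ∸ toℕ i)))
             (ℕ∣._∣_.equality (divisible i)) ⟩
      (ℕ∣.quotient (divisible i) * suc n) · (x ^ˢ suc (toℕ i) ⊗ y ^ˢ (n ∸ toℕ i))
        ≡⟨ cong (_· (x ^ˢ suc (toℕ i) ⊗ y ^ˢ (n ∸ toℕ i))) (ℕₚ.*-comm (ℕ∣.quotient (divisible i)) (suc n)) ⟩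
      (suc n * ℕ∣.quotient (divisible i)) · (x ^ˢ suc (toℕ i) ⊗ y ^ˢ (n ∸ toℕ i))
        ≈⟨ ≈-sym (×-assocˡ (x ^ˢ suc (toℕ i) ⊗ y ^ˢ (n ∸ toℕ i)) (suc n) (ℕ∣.quotient (divisible i))) ⟩
      suc n · quot i ∎

  frobenius-sum : ∀ {t} → Prime t → ∀ {n} (f : Fin n → Carrier) →
    ∃[ z ] sum f ^ˢ t ≈ sum (λ i → f i ^ˢ t) ⊕ t · z
  frobenius-sum {zero}  pr         = contradiction pr ¬prime[0]
  frobenius-sum {suc t} pr {zero}  f = 0# , (begin
    0# ⊗ 0# ^ˢ t            ≈⟨ zeroˡ _ ⟩
    0#                     ≈⟨ ≈-sym (sum-× {0} (suc t) (λ ())) ⟨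
    suc t · 0#             ≈⟨ +-identityˡ _ ⟨
    0# ⊕ suc t · 0#        ∎)
  frobenius-sum {t} pr {suc n} f
    with frobenius-+ pr (f fzero) (sum (λ i → f (fsuc i))) | frobenius-sum pr (λ i → f (fsuc i))
  ... | z₁ , e₁ | z₂ , e₂ = z₂ ⊕ z₁ , (begin
    (f fzero ⊕ sum (λ i → f (fsuc i))) ^ˢ t                         ≈⟨ e₁ ⟩
    (f fzero ^ˢ t ⊕ sum (λ i → f (fsuc i)) ^ˢ t) ⊕ t · z₁            ≈⟨ +-congʳ (+-congˡ e₂) ⟩
    (f fzero ^ˢ t ⊕ (sum (λ i → f (fsuc i) ^ˢ t) ⊕ t · z₂)) ⊕ t · z₁ ≈⟨ +-congʳ (≈-sym (+-assoc _ _ _)) ⟩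
    (sum (λ i → f i ^ˢ t) ⊕ t · z₂) ⊕ t · z₁                        ≈⟨ +-assoc _ _ _ ⟩
    sum (λ i → f i ^ˢ t) ⊕ (t · z₂ ⊕ t · z₁)                        ≈⟨ +-congˡ (≈-sym (×-distrib-+ z₂ z₁ t)) ⟩
    sum (λ i → f i ^ˢ t) ⊕ t · (z₂ ⊕ z₁)                            ∎)

-- Finite sums of integers and indicator functions.

import Algebra.Properties.Semiring.Sum ℤₚ.+-*-semiring as Sum
open import Algebra.Properties.Semiring.Exp ℤₚ.+-*-semiring
  using () renaming (_^_ to _^ᶻ_)

-- Opaque, so that the length and the summand can be inferred from an equation between sums.
opaque
  ∑ : (Fin n → ℤ) → ℤ
  ∑ = Sum.sum

  ∑-cong : {f g : Fin n → ℤ} → (∀ x → f x ≡ g x) → ∑ f ≡ ∑ g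
  ∑-cong = Sum.sum-cong-≗

  ∑-distrib-+ : (f g : Fin n → ℤ) → ∑ (λ x → f x +ᶻ g x) ≡ ∑ f +ᶻ ∑ g
  ∑-distrib-+ = Sum.∑-distrib-+

  ∑-comm : (f : Fin m → Fin n → ℤ) → ∑ (λ x → ∑ λ y → f x y) ≡ ∑ (λ y → ∑ λ x → f x y)
  ∑-comm = Sum.∑-comm

  ∑-*ˡ : ∀ c (f : Fin n → ℤ) → ∑ (λ x → c *ᶻ f x) ≡ c *ᶻ ∑ f
  ∑-*ˡ c f = sym (Sum.*-distribˡ-sum c f)

  ∑-*ʳ : ∀ c (f : Fin n → ℤ) → ∑ (λ x → f x *ᶻ c) ≡ ∑ f *ᶻ c
  ∑-*ʳ c f = sym (Sum.*-distribʳ-sum c f)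

  ∑-reindex : (σ τ : Fin n → Fin n) → (∀ x → σ (τ x) ≡ x) → (∀ x → τ (σ x) ≡ x) →
    (f : Fin n → ℤ) → ∑ (λ x → f (σ x)) ≡ ∑ f
  ∑-reindex σ τ στ τσ f = sym (Sum.sum-permute f (permutation σ τ στ τσ))

  ∑-zero : {f : Fin n → ℤ} → (∀ x → f x ≡ 0ℤ) → ∑ f ≡ 0ℤ
  ∑-zero {n} eq = trans (∑-cong eq) (Sum.sum-replicate-zero n)

  ∑-const : ∀ n c → ∑ {n} (λ _ → c) ≡ + n *ᶻ c
  ∑-const zero    c = sym (ℤₚ.*-zeroˡ c)
  ∑-const (suc n) c = trans (cong (c +ᶻ_) (∑-const n c)) (lemma c (+ n))
    where
    lemma : ∀ c m → c +ᶻ m *ᶻ c ≡ (1ℤ +ᶻ m) *ᶻ c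
    lemma = ℤ-Solver.solve-∀

𝟙 : Dec P → ℤ
𝟙 (yes _) = 1ℤ
𝟙 (no _)  = 0ℤ

𝟙-yes : (d : Dec P) → P → 𝟙 d ≡ 1ℤ
𝟙-yes (yes _) p = refl
𝟙-yes (no ¬p) p = contradiction p ¬p

𝟙-no : (d : Dec P) → ¬ P → 𝟙 d ≡ 0ℤ
𝟙-no (yes p) ¬p = contradiction p ¬p
𝟙-no (no _)  ¬p = refl

𝟙-cong : (d : Dec P) (e : Dec P′) → (P → P′) → (P′ → P) → 𝟙 d ≡ 𝟙 e
𝟙-cong (yes p) e f g = sym (𝟙-yes e (f p))
𝟙-cong (no ¬p) e f g = sym (𝟙-no e (λ q → ¬p (g q)))

𝟙-× : (d : Dec P) (e : Dec P′) → 𝟙 (d ×-dec e) ≡ 𝟙 d *ᶻ 𝟙 e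
𝟙-× (yes _) (yes _) = refl
𝟙-× (yes _) (no _)  = refl
𝟙-× (no _)  (yes _) = refl
𝟙-× (no _)  (no _)  = refl

δ : Fin n → Fin n → ℤ
δ x y = 𝟙 (x ≟ y)

δ-sym : (x y : Fin n) → δ x y ≡ δ y x
δ-sym x y = 𝟙-cong (x ≟ y) (y ≟ x) sym sym

δ-refl : (x : Fin n) → δ x x ≡ 1ℤ
δ-refl x = 𝟙-yes (x ≟ x) refl

opaque
  unfolding ∑

  ∑-δ : (x : Fin n) (f : Fin n → ℤ) → ∑ (λ y → δ x y *ᶻ f y) ≡ f x
  ∑-δ {suc n} fzero f = begin
    1ℤ *ᶻ f fzero +ᶻ ∑ (λ y → 0ℤ *ᶻ f (fsuc y))
      ≡⟨ cong₂ _+ᶻ_ (ℤₚ.*-identityˡ (f fzero)) (∑-zero {n} (λ y → ℤₚ.*-zeroˡ (f (fsuc y)))) ⟩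
    f fzero +ᶻ 0ℤ                               ≡⟨ ℤₚ.+-identityʳ _ ⟩
    f fzero ∎
    where open ≡-Reasoning
  ∑-δ {suc n} (fsuc x) f = begin
    0ℤ *ᶻ f fzero +ᶻ ∑ (λ y → δ (fsuc x) (fsuc y) *ᶻ f (fsuc y))
      ≡⟨ cong₂ _+ᶻ_ (ℤₚ.*-zeroˡ (f fzero)) (∑-cong (λ y → cong (_*ᶻ f (fsuc y)) (𝟙-cong (fsuc x ≟ fsuc y)
            (x ≟ y) fsuc-injective (cong fsuc)))) ⟩
    0ℤ +ᶻ ∑ (λ y → δ x y *ᶻ f (fsuc y))
      ≡⟨ trans (ℤₚ.+-identityˡ _) (∑-δ x (λ y → f (fsuc y))) ⟩
    f (fsuc x) ∎
    where open ≡-Reasoning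

∑-δʳ : (x : Fin n) (f : Fin n → ℤ) → ∑ (λ y → f y *ᶻ δ x y) ≡ f x
∑-δʳ x f = trans (∑-cong (λ y → ℤₚ.*-comm (f y) (δ x y))) (∑-δ x f)

-- The integral group ring of a finite abelian group.

module GroupRing {v : ℕ} (G : FinAbelianGroup v) where
  open FinAbelianGroup G public
  abelianGroup : AbelianGroup _ _
  abelianGroup = record { isAbelianGroup = isAbelianGroup }
  open IsAbelianGroup isAbelianGroup public
    using (assoc; identityˡ; identityʳ; inverseˡ; inverseʳ; comm)
  open import Algebra.Properties.CommutativeMonoid.Mult
    (AbelianGroup.commutativeMonoid abelianGroup) public
    using () renaming (_×_ to infixr 7 _•_; ×-homo-+ to •-homo-+; ×-assocˡ to •-assoc; ×-distrib-+ to •-distrib-∙; ×-homo-1 to •-homo-1)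

  infixl 7 _⊛_
  infix 4 _≐_

  Elem : Set
  Elem = Fin v → ℤ

  _≐_ : Elem → Elem → Set
  f ≐ g = ∀ x → f x ≡ g x

  -- Convolution in symmetric form: `δ` selects the pairs with product x. No inverse occurs, and
  -- commutativity is an exchange of the two sums.
  _⊛_ : Elem → Elem → Elem
  (f ⊛ g) x = ∑ λ a → ∑ λ b → f a *ᶻ g b *ᶻ δ (a ∙ b) x

  ⊛-cong : ∀ {f f′ g g′} → f ≐ f′ → g ≐ g′ → f ⊛ g ≐ f′ ⊛ g′
  ⊛-cong ff gg x = ∑-cong λ a → ∑-cong λ b → cong₂ (λ p q → p *ᶻ q *ᶻ δ (a ∙ b) x) (ff a) (gg b)

  ⊛-congʳ : ∀ f {g g′} → g ≐ g′ → f ⊛ g ≐ f ⊛ g′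
  ⊛-congʳ f = ⊛-cong {f} (λ _ → refl)

  -- Pairing with a test function removes the convolution. Suitable choices of `φ` give
  -- associativity, the sum of all coefficients of a product, and compatibility with the projection
  -- to the Sylow 3-subgroup.
  ∑-⊛ : ∀ f g (φ : Elem) →
    ∑ (λ x → (f ⊛ g) x *ᶻ φ x) ≡ ∑ λ a → ∑ λ b → f a *ᶻ g b *ᶻ φ (a ∙ b)
  ∑-⊛ f g φ = begin
    ∑ (λ x → (f ⊛ g) x *ᶻ φ x)
      ≡⟨ ∑-cong (λ x → sym (∑-*ʳ (φ x) _)) ⟩
    ∑ (λ x → ∑ λ a → (∑ λ b → f a *ᶻ g b *ᶻ δ (a ∙ b) x) *ᶻ φ x)
      ≡⟨ ∑-comm _ ⟩
    ∑ (λ a → ∑ λ x → (∑ λ b → f a *ᶻ g b *ᶻ δ (a ∙ b) x) *ᶻ φ x)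
      ≡⟨ ∑-cong (λ a → ∑-cong λ x → sym (∑-*ʳ (φ x) _)) ⟩
    ∑ (λ a → ∑ λ x → ∑ λ b → f a *ᶻ g b *ᶻ δ (a ∙ b) x *ᶻ φ x)
      ≡⟨ ∑-cong (λ a → ∑-comm _) ⟩
    ∑ (λ a → ∑ λ b → ∑ λ x → f a *ᶻ g b *ᶻ δ (a ∙ b) x *ᶻ φ x)
      ≡⟨ ∑-cong (λ a → ∑-cong λ b → trans
           (∑-cong λ x → ℤₚ.*-assoc (f a *ᶻ g b) (δ (a ∙ b) x) (φ x))
           (trans (∑-*ˡ (f a *ᶻ g b) _) (cong (f a *ᶻ g b *ᶻ_) (∑-δ (a ∙ b) φ)))) ⟩
    (∑ λ a → ∑ λ b → f a *ᶻ g b *ᶻ φ (a ∙ b)) ∎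
    where open ≡-Reasoning

  ⊛-comm : ∀ f g → f ⊛ g ≐ g ⊛ f
  ⊛-comm f g x = trans (∑-comm _) (∑-cong λ b → ∑-cong λ a →
    cong₂ _*ᶻ_ (ℤₚ.*-comm (f a) (g b)) (cong (λ y → δ y x) (comm a b)))

  ⊛-assoc : ∀ f g h → (f ⊛ g) ⊛ h ≐ f ⊛ (g ⊛ h)
  ⊛-assoc f g h x = begin
    ∑ (λ a → ∑ λ c → (f ⊛ g) a *ᶻ h c *ᶻ δ (a ∙ c) x)
      ≡⟨ ∑-cong (λ a → trans (∑-cong λ c → ℤₚ.*-assoc ((f ⊛ g) a) (h c) (δ (a ∙ c) x)) (∑-*ˡ ((f ⊛ g) a) _)) ⟩
    ∑ (λ a → (f ⊛ g) a *ᶻ ∑ λ c → h c *ᶻ δ (a ∙ c) x)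
      ≡⟨ ∑-⊛ f g _ ⟩
    ∑ (λ a → ∑ λ b → f a *ᶻ g b *ᶻ ∑ λ c → h c *ᶻ δ ((a ∙ b) ∙ c) x)
      ≡⟨ ∑-cong (λ a → ∑-cong λ b → step a b) ⟩
    ∑ (λ a → ∑ λ b → f a *ᶻ ∑ λ c → g b *ᶻ h c *ᶻ δ (a ∙ (b ∙ c)) x)
      ≡⟨ ∑-cong (λ a → trans (∑-*ˡ (f a) _) (cong (f a *ᶻ_) (sym (∑-⊛ g h (λ b → δ (a ∙ b) x))))) ⟩
    ∑ (λ a → f a *ᶻ ∑ λ b → (g ⊛ h) b *ᶻ δ (a ∙ b) x)
      ≡⟨ ∑-cong (λ a → trans (sym (∑-*ˡ (f a) _)) (∑-cong λ b → sym (ℤₚ.*-assoc (f a) ((g ⊛ h) b) (δ (a ∙ b) x)))) ⟩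
    ∑ (λ a → ∑ λ b → f a *ᶻ (g ⊛ h) b *ᶻ δ (a ∙ b) x) ∎
    where
    open ≡-Reasoning
    step : ∀ a b → (f a *ᶻ g b *ᶻ ∑ λ c → h c *ᶻ δ ((a ∙ b) ∙ c) x)
                 ≡ (f a *ᶻ ∑ λ c → g b *ᶻ h c *ᶻ δ (a ∙ (b ∙ c)) x)
    step a b = trans (ℤₚ.*-assoc (f a) (g b) _) (cong (f a *ᶻ_) (trans (sym (∑-*ˡ (g b) _))
      (∑-cong λ c → trans (sym (ℤₚ.*-assoc (g b) (h c) _))
        (cong (λ y → g b *ᶻ h c *ᶻ δ y x) (assoc a b c)))))

  single : Fin v → ℤ → Elem
  single d c x = c *ᶻ δ d x

  single-⊛ : ∀ d c g x → (single d c ⊛ g) x ≡ c *ᶻ ∑ λ b → g b *ᶻ δ (d ∙ b) x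
  single-⊛ d c g x = begin
    ∑ (λ a → ∑ λ b → c *ᶻ δ d a *ᶻ g b *ᶻ δ (a ∙ b) x)
      ≡⟨ ∑-cong (λ a → trans (∑-cong λ b → shuffle c (δ d a) (g b) (δ (a ∙ b) x)) (trans (∑-*ˡ c _) (cong
            (c *ᶻ_) (∑-*ˡ (δ d a) _)))) ⟩
    ∑ (λ a → c *ᶻ (δ d a *ᶻ ∑ λ b → g b *ᶻ δ (a ∙ b) x))
      ≡⟨ trans (∑-*ˡ c _) (cong (c *ᶻ_) (∑-δ d _)) ⟩
    (c *ᶻ ∑ λ b → g b *ᶻ δ (d ∙ b) x) ∎
    where
    open ≡-Reasoning
    shuffle : ∀ c d g e → c *ᶻ d *ᶻ g *ᶻ e ≡ c *ᶻ (d *ᶻ (g *ᶻ e))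
    shuffle = ℤ-Solver.solve-∀

  single-⊛-single : ∀ d c d′ c′ → single d c ⊛ single d′ c′ ≐ single (d ∙ d′) (c *ᶻ c′)
  single-⊛-single d c d′ c′ x = begin
    (single d c ⊛ single d′ c′) x                    ≡⟨ single-⊛ d c (single d′ c′) x ⟩
    (c *ᶻ ∑ λ b → c′ *ᶻ δ d′ b *ᶻ δ (d ∙ b) x)
      ≡⟨ cong (c *ᶻ_) (trans (∑-cong λ b → ℤₚ.*-assoc c′ (δ d′ b) _) (trans (∑-*ˡ c′ _) (cong (c′ *ᶻ_) (∑-δ d′ _)))) ⟩
    c *ᶻ (c′ *ᶻ δ (d ∙ d′) x)                         ≡⟨ ℤₚ.*-assoc c c′ _ ⟨
    single (d ∙ d′) (c *ᶻ c′) x                       ∎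
    where open ≡-Reasoning

  𝟘 ι : Elem
  𝟘 _ = 0ℤ
  ι = single ε 1ℤ

  infixl 6 _⊞_
  _⊞_ : Elem → Elem → Elem
  (f ⊞ g) x = f x +ᶻ g x

  scalar-⊛ : ∀ c g x → (single ε c ⊛ g) x ≡ c *ᶻ g x
  scalar-⊛ c g x = trans (single-⊛ ε c g x) (cong (c *ᶻ_)
    (trans (∑-cong λ b → cong (g b *ᶻ_) (trans (cong (λ y → δ y x) (identityˡ b)) (δ-sym b x))) (∑-δʳ x g)))

  ⊛-identityˡ : ∀ f → ι ⊛ f ≐ f
  ⊛-identityˡ f x = trans (scalar-⊛ 1ℤ f x) (ℤₚ.*-identityˡ (f x))

  ⊛-distribˡ : ∀ f g h → f ⊛ (g ⊞ h) ≐ f ⊛ g ⊞ f ⊛ h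
  ⊛-distribˡ f g h x = trans
    (∑-cong λ a → trans (∑-cong λ b → expand (f a) (g b) (h b) (δ (a ∙ b) x)) (∑-distrib-+ _ _))
    (∑-distrib-+ _ _)
    where
    expand : ∀ f g h d → f *ᶻ (g +ᶻ h) *ᶻ d ≡ f *ᶻ g *ᶻ d +ᶻ f *ᶻ h *ᶻ d
    expand = ℤ-Solver.solve-∀

  ⊛-zeroˡ : ∀ f → 𝟘 ⊛ f ≐ 𝟘
  ⊛-zeroˡ f x = ∑-zero λ a → ∑-zero λ b → refl

  ⊛-distribʳ : ∀ f g h → (g ⊞ h) ⊛ f ≐ g ⊛ f ⊞ h ⊛ f
  ⊛-distribʳ f g h x = begin
    ((g ⊞ h) ⊛ f) x            ≡⟨ ⊛-comm (g ⊞ h) f x ⟩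
    (f ⊛ (g ⊞ h)) x            ≡⟨ ⊛-distribˡ f g h x ⟩
    (f ⊛ g) x +ᶻ (f ⊛ h) x     ≡⟨ cong₂ _+ᶻ_ (⊛-comm f g x) (⊛-comm f h x) ⟩
    (g ⊛ f) x +ᶻ (h ⊛ f) x     ∎
    where open ≡-Reasoning

  ⊛-commutativeSemiring : CommutativeSemiring _ _
  ⊛-commutativeSemiring = record
    { Carrier = Elem ; _≈_ = _≐_ ; _+_ = _⊞_ ; _*_ = _⊛_ ; 0# = 𝟘 ; 1# = ι
    ; isCommutativeSemiring = record
      { isSemiring = record
        { isSemiringWithoutAnnihilatingZero = record
          { +-isCommutativeMonoid = Pointwise.isCommutativeMonoid (Fin v) ℤₚ.+-0-isCommutativeMonoid
          ; *-cong = ⊛-cong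
          ; *-assoc = ⊛-assoc
          ; *-identity = ⊛-identityˡ , λ f x → trans (⊛-comm f ι x) (⊛-identityˡ f x)
          ; distrib = ⊛-distribˡ , ⊛-distribʳ
          }
        ; zero = ⊛-zeroˡ , λ f x → trans (⊛-comm f 𝟘 x) (⊛-zeroˡ f x)
        }
      ; *-comm = ⊛-comm
      }
    }

-- Congruences between integers and Fermat's little theorem.

infix 4 _≋_[mod_]

record _≋_[mod_] (a b : ℤ) (m : ℕ) : Set where
  constructor by
  field
    quotient : ℤ
    equality : a ≡ b +ᶻ quotient *ᶻ + m

≋-reflexive : a ≡ b → a ≋ b [mod m ]
≋-reflexive {a} {m = m} refl = by 0ℤ (lemma a (+ m))
  where
  lemma : ∀ a m → a ≡ a +ᶻ 0ℤ *ᶻ m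
  lemma = ℤ-Solver.solve-∀

≋-refl : a ≋ a [mod m ]
≋-refl = ≋-reflexive refl

≋-sym : a ≋ b [mod m ] → b ≋ a [mod m ]
≋-sym {a} {b} {m} (by q refl) = by (- q) (lemma b q (+ m))
  where
  lemma : ∀ b q m → b ≡ b +ᶻ q *ᶻ m +ᶻ - q *ᶻ m
  lemma = ℤ-Solver.solve-∀

≋-trans : a ≋ b [mod m ] → b ≋ c [mod m ] → a ≋ c [mod m ]
≋-trans {m = m} {c = c} (by q refl) (by q′ refl) = by (q′ +ᶻ q) (lemma c q q′ (+ m))
  where
  lemma : ∀ c q q′ m → c +ᶻ q′ *ᶻ m +ᶻ q *ᶻ m ≡ c +ᶻ (q′ +ᶻ q) *ᶻ m
  lemma = ℤ-Solver.solve-∀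

≋-+ : a ≋ b [mod m ] → a′ ≋ b′ [mod m ] → a +ᶻ a′ ≋ b +ᶻ b′ [mod m ]
≋-+ {b = b} {m = m} {b′ = b′} (by q refl) (by q′ refl) = by (q +ᶻ q′) (lemma b b′ q q′ (+ m))
  where
  lemma : ∀ b b′ q q′ m → b +ᶻ q *ᶻ m +ᶻ (b′ +ᶻ q′ *ᶻ m) ≡ b +ᶻ b′ +ᶻ (q +ᶻ q′) *ᶻ m
  lemma = ℤ-Solver.solve-∀

≋-* : a ≋ b [mod m ] → a′ ≋ b′ [mod m ] → a *ᶻ a′ ≋ b *ᶻ b′ [mod m ]
≋-* {b = b} {m = m} {b′ = b′} (by q refl) (by q′ refl) =
  by (q *ᶻ b′ +ᶻ b *ᶻ q′ +ᶻ q *ᶻ q′ *ᶻ + m) (lemma b b′ q q′ (+ m))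
  where
  lemma : ∀ b b′ q q′ m → (b +ᶻ q *ᶻ m) *ᶻ (b′ +ᶻ q′ *ᶻ m)
        ≡ b *ᶻ b′ +ᶻ (q *ᶻ b′ +ᶻ b *ᶻ q′ +ᶻ q *ᶻ q′ *ᶻ m) *ᶻ m
  lemma = ℤ-Solver.solve-∀

≋-+-cancelʳ : ∀ c → a +ᶻ c ≋ b +ᶻ c [mod m ] → a ≋ b [mod m ]
≋-+-cancelʳ {a} {b} {m} c (by q e) = by q (begin
  a                            ≡⟨ lemma₁ a c ⟩
  a +ᶻ c +ᶻ - c                ≡⟨ cong (_+ᶻ - c) e ⟩
  b +ᶻ c +ᶻ q *ᶻ + m +ᶻ - c    ≡⟨ lemma₂ b c (q *ᶻ + m) ⟩
  b +ᶻ q *ᶻ + m                ∎)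
  where
  open ≡-Reasoning
  lemma₁ : ∀ a c → a ≡ a +ᶻ c +ᶻ - c
  lemma₁ = ℤ-Solver.solve-∀
  lemma₂ : ∀ b c d → b +ᶻ c +ᶻ d +ᶻ - c ≡ b +ᶻ d
  lemma₂ = ℤ-Solver.solve-∀

∑-≋ : {f g : Fin n → ℤ} → (∀ x → f x ≋ g x [mod m ]) → ∑ f ≋ ∑ g [mod m ]
∑-≋ {m = m} {f = f} {g = g} h = by (∑ (λ x → _≋_[mod_].quotient (h x))) (begin
  ∑ f                                                          ≡⟨ ∑-cong (λ x → _≋_[mod_].equality (h x)) ⟩
  ∑ (λ x → g x +ᶻ _≋_[mod_].quotient (h x) *ᶻ + m)             ≡⟨ ∑-distrib-+ g _ ⟩
  ∑ g +ᶻ ∑ (λ x → _≋_[mod_].quotient (h x) *ᶻ + m)             ≡⟨ cong (∑ g +ᶻ_) (∑-*ʳ (+ m) _) ⟩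
  ∑ g +ᶻ ∑ (λ x → _≋_[mod_].quotient (h x)) *ᶻ + m             ∎)
  where open ≡-Reasoning

≋0⇒∣ : ∀ {t m} → + m ≋ 0ℤ [mod t ] → t ℕ∣.∣ m
≋0⇒∣ {t} {m} (by q e) = ℕ∣.divides ℤ.∣ q ∣
  (trans (cong ℤ.∣_∣ (trans e (ℤₚ.+-identityˡ (q *ᶻ + t)))) (ℤₚ.abs-* q (+ t)))

∣⇒≋0 : ∀ {t m} → t ℕ∣.∣ m → + m ≋ 0ℤ [mod t ]
∣⇒≋0 {t} (ℕ∣.divides q refl) = by (+ q) (trans (ℤₚ.pos-* q t) (sym (ℤₚ.+-identityˡ _)))

open import Algebra.Definitions.RawMonoid (AbelianGroup.rawMonoid ℤₚ.+-0-abelianGroup)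
  using () renaming (_×_ to _×ᶻ_)

×ᶻ≡* : ∀ n a → n ×ᶻ a ≡ a *ᶻ + n
×ᶻ≡* zero    a = sym (ℤₚ.*-zeroʳ a)
×ᶻ≡* (suc n) a = trans (cong (a +ᶻ_) (×ᶻ≡* n a)) (lemma a (+ n))
  where
  lemma : ∀ a n → a +ᶻ a *ᶻ n ≡ a *ᶻ (1ℤ +ᶻ n)
  lemma = ℤ-Solver.solve-∀

1^ᶻ : ∀ n → 1ℤ ^ᶻ n ≡ 1ℤ
1^ᶻ zero    = refl
1^ᶻ (suc n) = trans (ℤₚ.*-identityˡ _) (1^ᶻ n)

module _ {t : ℕ} (pr : Prime t) where
  open Frobenius ℤₚ.+-*-commutativeSemiring

  ^ᶻ-+ : ∀ a b → (a +ᶻ b) ^ᶻ t ≋ a ^ᶻ t +ᶻ b ^ᶻ t [mod t ]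
  ^ᶻ-+ a b with z , e ← frobenius-+ pr a b = by z (trans e (cong (a ^ᶻ t +ᶻ b ^ᶻ t +ᶻ_) (×ᶻ≡* t z)))

  0^prime : 0ℤ ^ᶻ t ≡ 0ℤ
  0^prime = go pr
    where
    go : ∀ {t} → Prime t → 0ℤ ^ᶻ t ≡ 0ℤ
    go {zero}  pr = contradiction pr ¬prime[0]
    go {suc t} pr = ℤₚ.*-zeroˡ (0ℤ ^ᶻ t)

  fermat-+ : ∀ n → (+ n) ^ᶻ t ≋ + n [mod t ]
  fermat-+ zero    = ≋-reflexive 0^prime
  fermat-+ (suc n) = ≋-trans (^ᶻ-+ 1ℤ (+ n)) (≋-+ (≋-reflexive (1^ᶻ t)) (fermat-+ n))

  fermat : ∀ a → a ^ᶻ t ≋ a [mod t ]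
  fermat (+ n)      = fermat-+ n
  -- The number and `+ suc n` add up to zero, so additivity of the t-th power modulo t reduces to
  -- the natural case. The sign of (-1)ᵗ never appears, hence t = 2 needs no separate treatment.
  fermat (-[1+ n ]) = ≋-+-cancelʳ (+ suc n)
    (≋-trans (≋-+ (≋-refl {a = -[1+ n ] ^ᶻ t}) (≋-sym (fermat-+ (suc n))))
    (≋-trans (≋-sym (^ᶻ-+ -[1+ n ] (+ suc n)))
    (≋-reflexive (trans (cong (_^ᶻ t) (ℤₚ.+-inverseˡ (+ suc n)))
      (trans 0^prime (sym (ℤₚ.+-inverseˡ (+ suc n))))))))

-- Prime powers in the group ring, quadratic relations and multipliers.

module GroupFrobenius {v : ℕ} (G : FinAbelianGroup v) where
  open GroupRing G public
  open Frobenius ⊛-commutativeSemiring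
  open import Algebra.Properties.Semiring.Exp (CommutativeSemiring.semiring ⊛-commutativeSemiring)
    using (^-congˡ)
  open import Algebra.Definitions.RawSemiring (CommutativeSemiring.rawSemiring ⊛-commutativeSemiring) public
    using () renaming (_^_ to _^ᴳ_)
  open import Algebra.Definitions.RawMonoid (CommutativeSemiring.+-rawMonoid ⊛-commutativeSemiring)
    using () renaming (sum to sumᴳ; _×_ to _×ᴳ_)

  opaque
    unfolding ∑

    sumᴳ-apply : ∀ {n} (F : Fin n → Elem) x → sumᴳ F x ≡ ∑ λ i → F i x
    sumᴳ-apply {zero}  F x = refl
    sumᴳ-apply {suc n} F x = cong (F fzero x +ᶻ_) (sumᴳ-apply (λ i → F (fsuc i)) x)

  ×ᴳ-apply : ∀ t f x → (t ×ᴳ f) x ≡ f x *ᶻ + t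
  ×ᴳ-apply t f x = trans (go t) (×ᶻ≡* t (f x))
    where
    go : ∀ t → (t ×ᴳ f) x ≡ t ×ᶻ f x
    go zero    = refl
    go (suc t) = cong (f x +ᶻ_) (go t)

  single-^ : ∀ d c t → single d c ^ᴳ t ≐ single (t • d) (c ^ᶻ t)
  single-^ d c zero    x = refl
  single-^ d c (suc t) x = trans
    (⊛-congʳ (single d c) (single-^ d c t) x) (single-⊛-single d c (t • d) (c ^ᶻ t) x)

  -- In multiplicative notation, the element usually written f⁽ᵗ⁾ = Σ f(d) dᵗ.
  power : ℕ → Elem → Elem
  power t f x = ∑ λ d → f d *ᶻ δ (t • d) x

  -- Split f into its one-term parts. The t-th power of a term moves its group element from d to
  -- `t • d` and raises its coefficient to the t-th power, which Fermat's theorem undoes.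
  frobenius : ∀ {t} → Prime t → ∀ f x → (f ^ᴳ t) x ≋ power t f x [mod t ]
  frobenius {t} pr f x with z , e ← frobenius-sum pr (λ d → single d (f d)) =
    ≋-trans (by (z x) (begin
      (f ^ᴳ t) x
        ≡⟨ ^-congˡ t decompose x ⟩
      (sumᴳ (λ d → single d (f d)) ^ᴳ t) x
        ≡⟨ e x ⟩
      sumᴳ (λ d → single d (f d) ^ᴳ t) x +ᶻ (t ×ᴳ z) x
        ≡⟨ cong₂ _+ᶻ_ (trans (sumᴳ-apply (λ d → single d (f d) ^ᴳ t) x)
             (∑-cong λ d → single-^ d (f d) t x)) (×ᴳ-apply t z x) ⟩
      (∑ λ d → f d ^ᶻ t *ᶻ δ (t • d) x) +ᶻ z x *ᶻ + t ∎))
    (∑-≋ λ d → ≋-* (fermat pr (f d)) ≋-refl)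
    where
    open ≡-Reasoning
    decompose : f ≐ sumᴳ (λ d → single d (f d))
    decompose y = sym (trans (sumᴳ-apply _ y)
      (trans (∑-cong λ d → cong (f d *ᶻ_) (δ-sym d y)) (∑-δʳ y f)))

  ∑-translate : ∀ a (f : Elem) → ∑ (λ b → f (a ∙ b)) ≡ ∑ f
  ∑-translate a f = ∑-reindex (a ∙_) ((a ⁻¹) ∙_)
    (λ x → trans (sym (assoc a (a ⁻¹) x)) (trans (cong (_∙ x) (inverseʳ a)) (identityˡ x)))
    (λ x → trans (sym (assoc (a ⁻¹) a x)) (trans (cong (_∙ x) (inverseˡ a)) (identityˡ x))) f

  ⊛-const : ∀ f c x → (f ⊛ λ _ → c) x ≡ ∑ f *ᶻ c
  ⊛-const f c x = begin
    (∑ λ a → ∑ λ b → f a *ᶻ c *ᶻ δ (a ∙ b) x)  ≡⟨ ∑-cong (λ a → ∑-translate a (λ y → f a *ᶻ c *ᶻ δ y x)) ⟩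
    (∑ λ a → ∑ λ y → f a *ᶻ c *ᶻ δ y x)
      ≡⟨ ∑-cong (λ a → trans (∑-cong λ y → cong (f a *ᶻ c *ᶻ_) (δ-sym y x)) (∑-δʳ x (λ _ → f a *ᶻ c))) ⟩
    (∑ λ a → f a *ᶻ c)                         ≡⟨ ∑-*ʳ c f ⟩
    ∑ f *ᶻ c                                   ∎
    where open ≡-Reasoning

  ⊛-*ʳ : ∀ f g c x → (f ⊛ λ y → c *ᶻ g y) x ≡ c *ᶻ (f ⊛ g) x
  ⊛-*ʳ f g c x = trans (∑-cong λ a → trans
      (∑-cong λ b → lemma (f a) (g b) c (δ (a ∙ b) x)) (∑-*ˡ c _)) (∑-*ˡ c _)
    where
    lemma : ∀ f g c d → f *ᶻ (c *ᶻ g) *ᶻ d ≡ c *ᶻ (f *ᶻ g *ᶻ d)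
    lemma = ℤ-Solver.solve-∀

  ⊛-affine : ∀ f g c e x → (f ⊛ λ y → c *ᶻ g y +ᶻ e) x ≡ c *ᶻ (f ⊛ g) x +ᶻ ∑ f *ᶻ e
  ⊛-affine f g c e x = trans (⊛-distribˡ f (λ y → c *ᶻ g y) (λ _ → e) x)
    (cong₂ _+ᶻ_ (⊛-*ʳ f g c x) (⊛-const f e x))

  module Quadratic (f : Elem) (a c : ℤ) (f² : ∀ x → (f ⊛ f) x ≡ a *ᶻ f x +ᶻ c) where

    -- The multiple of G occurring in the power of f with exponent `suc j`. Multiplying a constant
    -- function by f scales it by `∑ f`.
    constant : ℕ → ℤ
    constant zero    = 0ℤ
    constant (suc j) = a ^ᶻ j *ᶻ c +ᶻ ∑ f *ᶻ constant j

    ^-affine : ∀ j x → (f ^ᴳ suc j) x ≡ a ^ᶻ j *ᶻ f x +ᶻ constant j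
    ^-affine zero    x = trans (⊛-comm f ι x) (trans (⊛-identityˡ f x) (lemma (f x)))
      where
      lemma : ∀ y → y ≡ 1ℤ *ᶻ y +ᶻ 0ℤ
      lemma = ℤ-Solver.solve-∀
    ^-affine (suc j) x = begin
      (f ⊛ (f ^ᴳ suc j)) x                               ≡⟨ ⊛-congʳ f (^-affine j) x ⟩
      (f ⊛ λ y → a ^ᶻ j *ᶻ f y +ᶻ constant j) x          ≡⟨ ⊛-affine f f (a ^ᶻ j) (constant j) x ⟩
      a ^ᶻ j *ᶻ (f ⊛ f) x +ᶻ ∑ f *ᶻ constant j           ≡⟨ cong (λ y → a ^ᶻ j *ᶻ y +ᶻ ∑ f *ᶻ constant j) (f² x) ⟩
      a ^ᶻ j *ᶻ (a *ᶻ f x +ᶻ c) +ᶻ ∑ f *ᶻ constant j     ≡⟨ lemma (a ^ᶻ j) a (f x) c (∑ f *ᶻ constant j) ⟩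
      a *ᶻ a ^ᶻ j *ᶻ f x +ᶻ (a ^ᶻ j *ᶻ c +ᶻ ∑ f *ᶻ constant j) ∎
      where
      open ≡-Reasoning
      lemma : ∀ p a y c r → p *ᶻ (a *ᶻ y +ᶻ c) +ᶻ r ≡ a *ᶻ p *ᶻ y +ᶻ (p *ᶻ c +ᶻ r)
      lemma = ℤ-Solver.solve-∀

    -- The t-th power of f has the factor a to the exponent t - 1 in front of f. One more factor a
    -- turns it into aᵗ ≡ a, which avoids dividing by a modulo t.
    power-affine : ∀ {t} → Prime t → ∃[ e ] ∀ x → a *ᶻ power t f x ≋ a *ᶻ f x +ᶻ e [mod t ]
    power-affine {zero}  pr = contradiction pr ¬prime[0]
    power-affine {suc j} pr = a *ᶻ constant j , λ x →
      ≋-trans (≋-* (≋-refl {a = a}) (≋-sym (frobenius pr f x)))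
      (≋-trans (≋-reflexive (trans (cong (a *ᶻ_) (^-affine j x)) (lemma a (a ^ᶻ j) (f x) (constant j))))
      (≋-+ (≋-* (fermat pr a) (≋-refl {a = f x})) ≋-refl))
      where
      lemma : ∀ a p y c → a *ᶻ (p *ᶻ y +ᶻ c) ≡ a *ᶻ p *ᶻ y +ᶻ a *ᶻ c
      lemma = ℤ-Solver.solve-∀

    power-injective : ∀ t → (∀ {x y} → t • x ≡ t • y → x ≡ y) → ∀ d → power t f (t • d) ≡ f d
    power-injective t inj d = trans
      (∑-cong λ y → cong (f y *ᶻ_) (𝟙-cong (t • y ≟ t • d) (d ≟ y) (λ e → inj (sym e)) (λ e → cong (t •_) (sym e))))
      (∑-δʳ d f)

    -- The unknown constant of `power-affine` is the same at every point, and it vanishes modulo t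
    -- at `ε`, which the power map fixes. Injectivity identifies the coefficient of `power t f` at
    -- `t • d` with `f d`.
    multiplier : ∀ {t} → Prime t → (∀ {x y} → t • x ≡ t • y → x ≡ y) → t • ε ≡ ε →
      ∀ d → a *ᶻ f (t • d) ≋ a *ᶻ f d [mod t ]
    multiplier {t} pr inj tε d with e , h ← power-affine pr =
      ≋-sym (≋-trans (≋-reflexive (cong (a *ᶻ_) (sym (power-injective t inj d))))
      (≋-trans (h (t • d)) (≋-trans (≋-+ (≋-refl {a = a *ᶻ f (t • d)}) e≋0)
      (≋-reflexive (ℤₚ.+-identityʳ _)))))
      where
      fε : power t f ε ≡ f ε
      fε = trans (cong (power t f) (sym tε)) (power-injective t inj ε)
      e≋0 : e ≋ 0ℤ [mod t ]
      e≋0 = ≋-+-cancelʳ (a *ᶻ f ε) (≋-trans (≋-reflexive (ℤₚ.+-comm e (a *ᶻ f ε)))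
        (≋-trans (≋-sym (h ε)) (≋-reflexive (trans (cong (a *ᶻ_) fε) (sym (ℤₚ.+-identityˡ _))))))

  private
    module GP = AbelianGroup abelianGroup
  open import Algebra.Properties.CommutativeMonoid.Sum GP.commutativeMonoid
    using () renaming (sum to ∏; ∑-distrib-+ to ∏-distrib-∙; sum-permute to ∏-permute; sum-replicate to ∏-replicate)
  open import Algebra.Properties.Group GP.group public
    using (∙-cancelˡ; ∙-cancelʳ)

  -- Translating by x permutes the group, so x ^ v = 1 by comparing products over all elements.
  order•≡ε : ∀ x → v • x ≡ ε
  order•≡ε x = ∙-cancelʳ (∏ {v} (λ y → y)) (v • x) ε (begin
    (v • x) ∙ ∏ (λ y → y)         ≡⟨ cong (_∙ ∏ (λ y → y)) (∏-replicate v) ⟨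
    ∏ {v} (λ _ → x) ∙ ∏ (λ y → y) ≡⟨ ∏-distrib-∙ {v} (λ _ → x) (λ y → y) ⟨
    ∏ (λ y → x ∙ y)               ≡⟨ ∏-permute (λ y → y) (permutation (x ∙_) ((x ⁻¹) ∙_)
      (λ y → trans (sym (assoc x (x ⁻¹) y)) (trans (cong (_∙ y) (inverseʳ x)) (identityˡ y)))
      (λ y → trans (sym (assoc (x ⁻¹) x y)) (trans (cong (_∙ y) (inverseˡ x)) (identityˡ y)))) ⟨
    ∏ {v} (λ y → y)               ≡⟨ identityˡ _ ⟨
    ε ∙ ∏ (λ y → y)               ∎)
    where open ≡-Reasoning

  •-ε : ∀ n → n • ε ≡ ε
  •-ε zero    = refl
  •-ε (suc n) = trans (identityˡ _) (•-ε n)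

  •-∣ : ∀ m n {x} → n • x ≡ ε → (m * n) • x ≡ ε
  •-∣ m n {x} e = trans (sym (•-assoc x m n)) (trans (cong (m •_) e) (•-ε m))

  -- Over ℕ the Bézout identity has two forms. In the first, multiplication by `i` undoes
  -- multiplication by t on elements killed by m; in the second, `i • (t • z)` is the inverse of z,
  -- so it can be cancelled.
  •-injective : ∀ {t m} → Coprime t m → ∀ {x y} → m • x ≡ ε → m • y ≡ ε → t • x ≡ t • y → x ≡ y
  •-injective {t} {m} co {x} {y} mx my e with coprime-Bézout co
  ... | Bézout.+- i j eq = trans (sym (recover mx)) (trans (cong (i •_) e) (recover my))
    where
    recover : ∀ {z} → m • z ≡ ε → i • (t • z) ≡ z
    recover {z} mz = begin
      i • (t • z)         ≡⟨ •-assoc z i t ⟩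
      (i * t) • z         ≡⟨ cong (_• z) (sym eq) ⟩
      z ∙ ((j * m) • z)   ≡⟨ cong (z ∙_) (•-∣ j m mz) ⟩
      z ∙ ε               ≡⟨ identityʳ z ⟩
      z                   ∎
      where open ≡-Reasoning
  ... | Bézout.-+ i j eq = ∙-cancelʳ (i • (t • x)) x y
      (trans (kill mx) (sym (trans (cong (λ w → y ∙ (i • w)) e) (kill my))))
    where
    kill : ∀ {z} → m • z ≡ ε → z ∙ (i • (t • z)) ≡ ε
    kill {z} mz = begin
      z ∙ (i • (t • z))   ≡⟨ cong (z ∙_) (•-assoc z i t) ⟩
      (1 + i * t) • z     ≡⟨ cong (_• z) eq ⟩
      (j * m) • z         ≡⟨ •-∣ j m mz ⟩
      ε                   ∎
      where open ≡-Reasoning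

-- Cardinalities and filtered lists as sums of indicators.

opaque
  unfolding ∑

  ∑-∈? : (D : Subset n) → ∑ (λ x → 𝟙 (x ∈? D)) ≡ + ∣ D ∣
  ∑-∈? []            = refl
  ∑-∈? (true  ∷ D) = cong (1ℤ +ᶻ_) (trans
    (∑-cong λ x → 𝟙-cong (fsuc x ∈? (true ∷ D)) (x ∈? D) drop-there there) (∑-∈? D))
  ∑-∈? (false ∷ D) = trans (ℤₚ.+-identityˡ _) (trans
    (∑-cong λ x → 𝟙-cong (fsuc x ∈? (false ∷ D)) (x ∈? D) drop-there there) (∑-∈? D))

  length-filter-tabulate : {P : X → Set} (P? : Decidable P) (f : Fin n → X) →
    + length (filter P? (tabulate f)) ≡ ∑ λ i → 𝟙 (P? (f i))
  length-filter-tabulate {n = zero}  P? f = refl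
  length-filter-tabulate {n = suc n} P? f with P? (f fzero)
  ... | yes _ = cong (1ℤ +ᶻ_) (length-filter-tabulate P? (λ i → f (fsuc i)))
  ... | no _  = trans (length-filter-tabulate P? (λ i → f (fsuc i))) (sym (ℤₚ.+-identityˡ _))

  length-filter-cartesianProduct : {P : X × Y → Set} (P? : Decidable P) (f : Fin m → X) (g : Fin n → Y) →
    + length (filter P? (cartesianProduct (tabulate f) (tabulate g))) ≡ ∑ λ i → ∑ λ j → 𝟙 (P? (f i , g j))
  length-filter-cartesianProduct {m = zero}  P? f g = refl
  length-filter-cartesianProduct {X = X} {Y = Y} {m = suc m} P? f g = begin
    + length (filter P? (map (f fzero ,_) (tabulate g) ++ rest))
      ≡⟨ cong (λ l → + length l) (filter-++ P? (map (f fzero ,_) (tabulate g)) rest) ⟩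
    + length (filter P? (map (f fzero ,_) (tabulate g)) ++ filter P? rest)
      ≡⟨ cong +_ (length-++ (filter P? (map (f fzero ,_) (tabulate g)))) ⟩
    + length (filter P? (map (f fzero ,_) (tabulate g))) +ᶻ + length (filter P? rest)
      ≡⟨ cong₂ _+ᶻ_
           (trans (cong (λ l → + length (filter P? l)) (map-tabulate g (f fzero ,_)))
                  (length-filter-tabulate P? (λ j → f fzero , g j)))
           (length-filter-cartesianProduct P? (λ i → f (fsuc i)) g) ⟩
    (∑ λ i → ∑ λ j → 𝟙 (P? (f i , g j))) ∎
    where
    open ≡-Reasoning
    rest : List (X × Y)
    rest = cartesianProduct (tabulate (λ i → f (fsuc i))) (tabulate g)

𝟙-idem : {P : Set} (d : Dec P) → 𝟙 d *ᶻ 𝟙 d ≡ 𝟙 d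
𝟙-idem (yes _) = refl
𝟙-idem (no _)  = refl

-- The group-ring equation of a partial difference set and its multipliers.

import Algebra.Properties.AbelianGroup ℤₚ.+-0-abelianGroup as ℤ-Group

prime[3] : Prime 3
prime[3] = from-yes (prime? 3)

module PDS {v r n : ℕ} (G : FinAbelianGroup v) (D : Subset v) (v≡n² : v ≡ n * n) (2r≢n : r + r ≢ n)
  (pds : IsPDS G D (r * (n + 1)) (- + n +ᶻ + (r * r + 3 * r)) (+ (r * r + r))) where
  open GroupFrobenius G public

  χ : Elem
  χ x = 𝟙 (x ∈? D)

  -- `β` is λ - μ, so that both representation counts take the single form β χ + μ.
  R N β μ : ℤ
  R = + r
  N = + n
  β = R +ᶻ R -ᶻ N
  μ = R *ᶻ R +ᶻ R

  +[r*r+r] : + (r * r + r) ≡ μ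
  +[r*r+r] = cong (_+ᶻ R) (ℤₚ.pos-* r r)

  +[r*r+3*r] : - N +ᶻ + (r * r + 3 * r) ≡ μ +ᶻ β
  +[r*r+3*r] = trans (cong₂ (λ a b → - N +ᶻ (a +ᶻ b)) (ℤₚ.pos-* r r) (ℤₚ.pos-* 3 r)) (lemma R N)
    where
    lemma : ∀ r n → - n +ᶻ (r *ᶻ r +ᶻ + 3 *ᶻ r) ≡ r *ᶻ r +ᶻ r +ᶻ (r +ᶻ r -ᶻ n)
    lemma = ℤ-Solver.solve-∀

  +v : + v ≡ N *ᶻ N
  +v = trans (cong +_ v≡n²) (ℤₚ.pos-* n n)

  ∑χ : ∑ χ ≡ R *ᶻ (N +ᶻ 1ℤ)
  ∑χ = trans (∑-∈? D) (trans (cong +_ (proj₁ pds)) (ℤₚ.pos-* r (n + 1)))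

  β≢0 : β ≢ 0ℤ
  β≢0 e = 2r≢n (ℤₚ.+-injective (ℤₚ.i-j≡0⇒i≡j (R +ᶻ R) N e))

  repCount-∑ : ∀ x → x ≢ ε → + repCount G D x ≡ ∑ λ g → ∑ λ h → χ g *ᶻ χ h *ᶻ δ (g ∙ (h ⁻¹)) x
  repCount-∑ x x≢ε = trans (length-filter-cartesianProduct _ (λ g → g) (λ h → h))
    (∑-cong λ g → ∑-cong λ h → begin
      𝟙 (g ∈? D ×-dec (h ∈? D ×-dec (¬? (g ≟ h) ×-dec (g ∙ (h ⁻¹) ≟ x))))
        ≡⟨ 𝟙-× (g ∈? D) _ ⟩
      χ g *ᶻ 𝟙 (h ∈? D ×-dec (¬? (g ≟ h) ×-dec (g ∙ (h ⁻¹) ≟ x)))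
        ≡⟨ cong (χ g *ᶻ_) (𝟙-× (h ∈? D) _) ⟩
      χ g *ᶻ (χ h *ᶻ 𝟙 (¬? (g ≟ h) ×-dec (g ∙ (h ⁻¹) ≟ x)))
        -- The condition g ≠ h is implied: g = h would make the quotient `ε`, which differs from x.
        ≡⟨ cong (λ y → χ g *ᶻ (χ h *ᶻ y)) (𝟙-cong (¬? (g ≟ h) ×-dec (g ∙ (h ⁻¹) ≟ x)) (g ∙ (h ⁻¹) ≟ x)
             proj₂ (λ e → (λ { refl → x≢ε (trans (sym e) (inverseʳ g)) }) , e)) ⟩
      χ g *ᶻ (χ h *ᶻ δ (g ∙ (h ⁻¹)) x)
        ≡⟨ ℤₚ.*-assoc (χ g) (χ h) _ ⟨
      χ g *ᶻ χ h *ᶻ δ (g ∙ (h ⁻¹)) x ∎)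
    where open ≡-Reasoning

  open import Algebra.Properties.Group (AbelianGroup.group abelianGroup)
    using (⁻¹-involutive; ε⁻¹≈ε)
  open import Algebra.Properties.AbelianGroup abelianGroup using (⁻¹-∙-comm)

  repCount-⁻¹ : ∀ x → x ≢ ε → + repCount G D (x ⁻¹) ≡ + repCount G D x
  repCount-⁻¹ x x≢ε = begin
    + repCount G D (x ⁻¹)                                       ≡⟨ repCount-∑ (x ⁻¹) (λ e → x≢ε (⁻¹≡ε e)) ⟩
    (∑ λ g → ∑ λ h → χ g *ᶻ χ h *ᶻ δ (g ∙ (h ⁻¹)) (x ⁻¹))       ≡⟨ ∑-comm _ ⟩
    (∑ λ h → ∑ λ g → χ g *ᶻ χ h *ᶻ δ (g ∙ (h ⁻¹)) (x ⁻¹))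
      ≡⟨ (∑-cong λ h → ∑-cong λ g → cong₂ _*ᶻ_ (ℤₚ.*-comm (χ g) (χ h)) (𝟙-cong (g ∙ (h ⁻¹) ≟ x ⁻¹) (h ∙
            (g ⁻¹) ≟ x) (to g h) (from g h))) ⟩
    (∑ λ h → ∑ λ g → χ h *ᶻ χ g *ᶻ δ (h ∙ (g ⁻¹)) x)            ≡⟨ repCount-∑ x x≢ε ⟨
    + repCount G D x                                            ∎
    where
    open ≡-Reasoning
    ⁻¹≡ε : x ⁻¹ ≡ ε → x ≡ ε
    ⁻¹≡ε e = trans (sym (⁻¹-involutive x)) (trans (cong _⁻¹ e) ε⁻¹≈ε)
    flip : ∀ g h → h ∙ (g ⁻¹) ≡ (g ∙ (h ⁻¹)) ⁻¹
    flip g h = trans (comm h (g ⁻¹)) (trans (cong ((g ⁻¹) ∙_) (sym (⁻¹-involutive h))) (⁻¹-∙-comm g (h ⁻¹)))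
    to : ∀ g h → g ∙ (h ⁻¹) ≡ x ⁻¹ → h ∙ (g ⁻¹) ≡ x
    to g h e = trans (flip g h) (trans (cong _⁻¹ e) (⁻¹-involutive x))
    from : ∀ g h → h ∙ (g ⁻¹) ≡ x → g ∙ (h ⁻¹) ≡ x ⁻¹
    from g h e = trans (flip h g) (cong _⁻¹ e)

  repCount-χ : ∀ x → x ≢ ε → + repCount G D x ≡ β *ᶻ χ x +ᶻ μ
  repCount-χ x x≢ε with x ∈? D
  ... | yes x∈D = trans (proj₁ (proj₂ pds) x x≢ε x∈D) (trans +[r*r+3*r] (lemma β μ))
    where
    lemma : ∀ b m → m +ᶻ b ≡ b *ᶻ 1ℤ +ᶻ m
    lemma = ℤ-Solver.solve-∀
  ... | no x∉D  = trans (proj₂ (proj₂ pds) x x≢ε x∉D) (trans +[r*r+r] (lemma β μ))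
    where
    lemma : ∀ b m → m ≡ b *ᶻ 0ℤ +ᶻ m
    lemma = ℤ-Solver.solve-∀

  -- Exchanging g and h shows that x and its inverse are represented equally often, and the number
  -- of representations determines membership because `β` is nonzero.
  χ-⁻¹ : ∀ x → χ (x ⁻¹) ≡ χ x
  χ-⁻¹ x with x ≟ ε
  ... | yes refl = cong χ ε⁻¹≈ε
  ... | no x≢ε = ℤₚ.*-cancelˡ-≡ β (χ (x ⁻¹)) (χ x) {{ℤ.≢-nonZero β≢0}}
      (ℤ-Group.∙-cancelʳ μ _ _ (trans (sym (repCount-χ (x ⁻¹) (λ e → x≢ε (trans (sym (⁻¹-involutive x)) (trans
            (cong _⁻¹ e) ε⁻¹≈ε)))))
        (trans (repCount-⁻¹ x x≢ε) (repCount-χ x x≢ε))))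

  χ⊛χ-≢ε : ∀ x → x ≢ ε → (χ ⊛ χ) x ≡ β *ᶻ χ x +ᶻ μ
  χ⊛χ-≢ε x x≢ε = begin
    (∑ λ g → ∑ λ h → χ g *ᶻ χ h *ᶻ δ (g ∙ h) x)
      ≡⟨ (∑-cong λ g → sym (∑-reindex _⁻¹ _⁻¹ ⁻¹-involutive ⁻¹-involutive (λ h → χ g *ᶻ χ h *ᶻ δ (g ∙ h) x))) ⟩
    (∑ λ g → ∑ λ h → χ g *ᶻ χ (h ⁻¹) *ᶻ δ (g ∙ (h ⁻¹)) x)
      ≡⟨ (∑-cong λ g → ∑-cong λ h → cong (λ y → χ g *ᶻ y *ᶻ δ (g ∙ (h ⁻¹)) x) (χ-⁻¹ h)) ⟩
    (∑ λ g → ∑ λ h → χ g *ᶻ χ h *ᶻ δ (g ∙ (h ⁻¹)) x)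
      ≡⟨ trans (sym (repCount-∑ x x≢ε)) (repCount-χ x x≢ε) ⟩
    β *ᶻ χ x +ᶻ μ ∎
    where open ≡-Reasoning

  χ⊛χ-ε : (χ ⊛ χ) ε ≡ R *ᶻ (N +ᶻ 1ℤ)
  χ⊛χ-ε = trans (∑-cong λ g → begin
    (∑ λ h → χ g *ᶻ χ h *ᶻ δ (g ∙ h) ε)
      ≡⟨ (∑-cong λ h → cong (χ g *ᶻ χ h *ᶻ_) (𝟙-cong (g ∙ h ≟ ε) (g ⁻¹ ≟ h) (to g h) (from g h))) ⟩
    (∑ λ h → χ g *ᶻ χ h *ᶻ δ (g ⁻¹) h)       ≡⟨ ∑-δʳ (g ⁻¹) (λ h → χ g *ᶻ χ h) ⟩
    χ g *ᶻ χ (g ⁻¹)                          ≡⟨ cong (χ g *ᶻ_) (χ-⁻¹ g) ⟩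
    χ g *ᶻ χ g                               ≡⟨ 𝟙-idem (g ∈? D) ⟩
    χ g                                      ∎) ∑χ
    where
    open ≡-Reasoning
    to : ∀ g h → g ∙ h ≡ ε → g ⁻¹ ≡ h
    to g h e = ∙-cancelˡ g (g ⁻¹) h (trans (inverseʳ g) (sym e))
    from : ∀ g h → g ⁻¹ ≡ h → g ∙ h ≡ ε
    from g h refl = inverseʳ g

  χ⊛χ : ∀ x → (χ ⊛ χ) x ≡ β *ᶻ χ x +ᶻ μ +ᶻ (R *ᶻ (N +ᶻ 1ℤ) -ᶻ μ -ᶻ β *ᶻ χ ε) *ᶻ δ ε x
  χ⊛χ x with ε ≟ x
  ... | yes refl = trans χ⊛χ-ε (lemma (R *ᶻ (N +ᶻ 1ℤ)) μ (β *ᶻ χ ε))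
    where
    lemma : ∀ k m b → k ≡ b +ᶻ m +ᶻ (k -ᶻ m -ᶻ b) *ᶻ 1ℤ
    lemma = ℤ-Solver.solve-∀
  ... | no ε≢x = trans (χ⊛χ-≢ε x (λ e → ε≢x (sym e))) (lemma (β *ᶻ χ x +ᶻ μ) (R *ᶻ (N +ᶻ 1ℤ) -ᶻ μ -ᶻ β *ᶻ χ ε))
    where
    lemma : ∀ a c → a ≡ a +ᶻ c *ᶻ 0ℤ
    lemma = ℤ-Solver.solve-∀

  -- Summing all coefficients of χ ⊛ χ pins down the coefficient of the identity.
  βχε≡0 : β *ᶻ χ ε ≡ 0ℤ
  βχε≡0 = solve-for (begin
    R *ᶻ (N +ᶻ 1ℤ) *ᶻ (R *ᶻ (N +ᶻ 1ℤ))
      ≡⟨ cong₂ _*ᶻ_ (sym ∑χ) (sym ∑χ) ⟩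
    ∑ χ *ᶻ ∑ χ
      ≡⟨ trans (sym (∑-*ʳ (∑ χ) χ)) (∑-cong λ g → trans (sym (∑-*ˡ (χ g) χ)) (∑-cong λ h → sym (ℤₚ.*-identityʳ _))) ⟩
    (∑ λ g → ∑ λ h → χ g *ᶻ χ h *ᶻ 1ℤ)
      ≡⟨ ∑-⊛ χ χ (λ _ → 1ℤ) ⟨
    (∑ λ x → (χ ⊛ χ) x *ᶻ 1ℤ)
      ≡⟨ (∑-cong λ x → trans (ℤₚ.*-identityʳ _) (χ⊛χ x)) ⟩
    (∑ λ x → β *ᶻ χ x +ᶻ μ +ᶻ κ *ᶻ δ ε x)
      ≡⟨ trans (∑-distrib-+ _ _) (cong₂ _+ᶻ_ (∑-distrib-+ _ _) (∑-δʳ ε (λ _ → κ))) ⟩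
    (∑ λ x → β *ᶻ χ x) +ᶻ (∑ {v} λ x → μ) +ᶻ κ
      ≡⟨ cong (_+ᶻ κ) (cong₂ _+ᶻ_ (trans (∑-*ˡ β χ) (cong (β *ᶻ_) ∑χ)) (trans (∑-const v μ) (cong (_*ᶻ μ) +v))) ⟩
    β *ᶻ (R *ᶻ (N +ᶻ 1ℤ)) +ᶻ N *ᶻ N *ᶻ μ +ᶻ κ ∎)
    where
    open ≡-Reasoning
    κ = R *ᶻ (N +ᶻ 1ℤ) -ᶻ μ -ᶻ β *ᶻ χ ε
    identity : ∀ R N b → b ≡ (R +ᶻ R -ᶻ N) *ᶻ (R *ᶻ (N +ᶻ 1ℤ)) +ᶻ N *ᶻ N *ᶻ (R *ᶻ R +ᶻ R)
      +ᶻ (R *ᶻ (N +ᶻ 1ℤ) -ᶻ (R *ᶻ R +ᶻ R)) -ᶻ (((R +ᶻ R -ᶻ N) *ᶻ (R *ᶻ (N +ᶻ 1ℤ)) +ᶻ N *ᶻ N *ᶻ (R *ᶻ R +ᶻ R)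
      +ᶻ (R *ᶻ (N +ᶻ 1ℤ) -ᶻ (R *ᶻ R +ᶻ R) -ᶻ b)))
    identity = ℤ-Solver.solve-∀
    -- The standard counting identity k² = β k + v μ + (k - μ), with k = r (n + 1) and v = n². It
    -- already balances, so the remaining term β χ(ε) has to vanish.
    identity′ : ∀ R N → (R +ᶻ R -ᶻ N) *ᶻ (R *ᶻ (N +ᶻ 1ℤ)) +ᶻ N *ᶻ N *ᶻ (R *ᶻ R +ᶻ R)
      +ᶻ (R *ᶻ (N +ᶻ 1ℤ) -ᶻ (R *ᶻ R +ᶻ R)) ≡ R *ᶻ (N +ᶻ 1ℤ) *ᶻ (R *ᶻ (N +ᶻ 1ℤ))
    identity′ = ℤ-Solver.solve-∀
    solve-for : R *ᶻ (N +ᶻ 1ℤ) *ᶻ (R *ᶻ (N +ᶻ 1ℤ)) ≡ β *ᶻ (R *ᶻ (N +ᶻ 1ℤ)) +ᶻ N *ᶻ N *ᶻ μ +ᶻ κ → β *ᶻ χ ε ≡ 0ℤ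
    solve-for e = trans (identity R N (β *ᶻ χ ε))
      (trans (cong₂ _-ᶻ_ (identity′ R N) (sym e)) (ℤₚ.+-inverseʳ (R *ᶻ (N +ᶻ 1ℤ) *ᶻ (R *ᶻ (N +ᶻ 1ℤ)))))

  ε∉D : ε ∉ D
  ε∉D ε∈D = β≢0 (trans (trans (sym (ℤₚ.*-identityʳ β)) (cong (β *ᶻ_) (sym (𝟙-yes (ε ∈? D) ε∈D)))) βχε≡0)

  ≢ε : ∀ {x} → x ∈ D → x ≢ ε
  ≢ε x∈D refl = ε∉D x∈D

  -- The shift by r makes the nontrivial eigenvalues of D equal to 0 and − n.
  shifted : Elem
  shifted = χ ⊞ single ε (- R)

  shifted² : ∀ x → (shifted ⊛ shifted) x ≡ - N *ᶻ shifted x +ᶻ μ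
  shifted² x = begin
    (shifted ⊛ shifted) x
      ≡⟨ ⊛-distribʳ shifted χ (single ε (- R)) x ⟩
    (χ ⊛ shifted) x +ᶻ (single ε (- R) ⊛ shifted) x
      ≡⟨ cong₂ _+ᶻ_ (trans (⊛-distribˡ χ χ (single ε (- R)) x)
           (cong ((χ ⊛ χ) x +ᶻ_) (trans (⊛-comm χ (single ε (- R)) x) (scalar-⊛ (- R) χ x))))
           (scalar-⊛ (- R) shifted x) ⟩
    (χ ⊛ χ) x +ᶻ - R *ᶻ χ x +ᶻ - R *ᶻ shifted x
      ≡⟨ cong (λ y → y +ᶻ - R *ᶻ χ x +ᶻ - R *ᶻ shifted x) (trans (χ⊛χ x)
          (cong (λ b → β *ᶻ χ x +ᶻ μ +ᶻ (R *ᶻ (N +ᶻ 1ℤ) -ᶻ μ -ᶻ b) *ᶻ δ ε x) βχε≡0)) ⟩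
    β *ᶻ χ x +ᶻ μ +ᶻ (R *ᶻ (N +ᶻ 1ℤ) -ᶻ μ -ᶻ 0ℤ) *ᶻ δ ε x +ᶻ - R *ᶻ χ x +ᶻ - R *ᶻ shifted x
      ≡⟨ lemma R N (χ x) (δ ε x) ⟩
    - N *ᶻ shifted x +ᶻ μ ∎
    where
    open ≡-Reasoning
    lemma : ∀ R N c d → (R +ᶻ R -ᶻ N) *ᶻ c +ᶻ (R *ᶻ R +ᶻ R) +ᶻ (R *ᶻ (N +ᶻ 1ℤ) -ᶻ (R *ᶻ R +ᶻ R) -ᶻ 0ℤ) *ᶻ d
        +ᶻ - R *ᶻ c +ᶻ - R *ᶻ (c +ᶻ - R *ᶻ d)
      ≡ - N *ᶻ (c +ᶻ - R *ᶻ d) +ᶻ (R *ᶻ R +ᶻ R)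
    lemma = ℤ-Solver.solve-∀

  ∑-shifted : ∑ shifted ≡ R *ᶻ N
  ∑-shifted = trans (∑-distrib-+ _ _) (trans (cong₂ _+ᶻ_ ∑χ (∑-δʳ ε (λ _ → - R))) (lemma R N))
    where
    lemma : ∀ R N → R *ᶻ (N +ᶻ 1ℤ) +ᶻ - R ≡ R *ᶻ N
    lemma = ℤ-Solver.solve-∀

  open Quadratic shifted (- N) μ shifted²

  shifted-∈ : ∀ {x} → x ∈ D → shifted x ≡ 1ℤ
  shifted-∈ {x} x∈D = trans (cong₂ (λ a b → a +ᶻ - R *ᶻ b) (𝟙-yes (x ∈? D) x∈D) (𝟙-no (ε ≟ x) (λ e → ≢ε x∈D (sym e))))
    (cong (1ℤ +ᶻ_) (ℤₚ.*-zeroʳ (- R)))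

  shifted-∉ : ∀ {x} → x ∉ D → x ≢ ε → shifted x ≡ 0ℤ
  shifted-∉ {x} x∉D x≢ε = trans (cong₂ (λ a b → a +ᶻ - R *ᶻ b) (𝟙-no (x ∈? D) x∉D) (𝟙-no (ε ≟ x) (λ e → x≢ε (sym e))))
    (trans (ℤₚ.+-identityˡ _) (ℤₚ.*-zeroʳ (- R)))

  -- Away from `ε` the coefficients of `shifted` are 0 and 1. If d were in D and `t • d` outside,
  -- `multiplier` would read n ≡ 0 modulo t, so t would divide v = n².
  prime-multiplier : ∀ {t} → Prime t → Coprime t v → ∀ {d} → d ∈ D → t • d ∈ D
  prime-multiplier {t} pr co {d} d∈D with t • d ∈? D
  ... | yes td∈D = td∈D
  ... | no td∉D  = contradiction
      (subst Prime (co (ℕ∣.∣-refl , subst (t ℕ∣.∣_) (sym v≡n²) (ℕ∣.∣m⇒∣m*n n (≋0⇒∣ N≋0)))) pr) ¬prime[1]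
    where
    inj : ∀ {x y} → t • x ≡ t • y → x ≡ y
    inj {x} {y} = •-injective co (order•≡ε x) (order•≡ε y)
    td≢ε : t • d ≢ ε
    td≢ε e = ≢ε d∈D (inj (trans e (sym (•-ε t))))
    -N≋0 : - N ≋ 0ℤ [mod t ]
    -N≋0 = ≋-trans (≋-reflexive (trans (sym (ℤₚ.*-identityʳ (- N))) (cong (- N *ᶻ_) (sym (shifted-∈ d∈D)))))
      (≋-trans (≋-sym (multiplier pr inj (•-ε t) d))
      (≋-reflexive (trans (cong (- N *ᶻ_) (shifted-∉ td∉D td≢ε)) (ℤₚ.*-zeroʳ (- N)))))
    N≋0 : N ≋ 0ℤ [mod t ]
    N≋0 = ≋-trans (≋-reflexive (lemma N)) (≋-* (≋-refl {a = - 1ℤ}) -N≋0)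
      where
      lemma : ∀ n → n ≡ - 1ℤ *ᶻ - n
      lemma = ℤ-Solver.solve-∀

  D-multiplier : ∀ m → .{{NonZero m}} → Coprime m v → ∀ {d} → d ∈ D → m • d ∈ D
  D-multiplier m co {d} d∈D = subst (λ k → k • d ∈ D) (sym isFactorisation)
    (go factors factorsPrime (subst (λ k → Coprime k v) isFactorisation co))
    where
    open PrimeFactorisation (factorise m)
    go : ∀ ts → All Prime ts → Coprime (product ts) v → product ts • d ∈ D
    go [] [] _ = subst (_∈ D) (sym (•-homo-1 d)) d∈D
    go (t ∷ ts) (pr ∷ prs) co = subst (_∈ D) (•-assoc d t (product ts))
      (prime-multiplier pr (λ (i , j) → co (ℕ∣.∣m⇒∣m*n (product ts) i , j))
        (go ts prs (λ (i , j) → co (ℕ∣.∣n⇒∣m*n t i , j))))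

  module _ (N≋0 : N ≋ 0ℤ [mod 3 ]) where

    -- Every coefficient of the cube of `shifted` is a multiple of n: its quadratic relation has
    -- linear coefficient -n, and its coefficients sum to r n.
    power-3-shifted : ∀ x → power 3 shifted x ≋ 0ℤ [mod 3 ]
    power-3-shifted x = ≋-trans (≋-sym (frobenius prime[3] shifted x))
      (≋-trans (≋-reflexive (trans (^-affine 2 x) (trans (cong (λ s → - N *ᶻ (- N *ᶻ 1ℤ) *ᶻ shifted x +ᶻ
            (- N *ᶻ 1ℤ *ᶻ μ +ᶻ s *ᶻ (1ℤ *ᶻ μ +ᶻ s *ᶻ 0ℤ))) ∑-shifted) (lemma R N μ (shifted x)))))
      (≋-trans (≋-* (≋-refl {a = N *ᶻ shifted x -ᶻ μ +ᶻ R *ᶻ μ}) N≋0)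
      (≋-reflexive (ℤₚ.*-zeroʳ (N *ᶻ shifted x -ᶻ μ +ᶻ R *ᶻ μ)))))
      where
      lemma : ∀ R N μ s → - N *ᶻ (- N *ᶻ 1ℤ) *ᶻ s +ᶻ (- N *ᶻ 1ℤ *ᶻ μ +ᶻ R *ᶻ N *ᶻ (1ℤ *ᶻ μ +ᶻ R *ᶻ N *ᶻ 0ℤ))
        ≡ (N *ᶻ s -ᶻ μ +ᶻ R *ᶻ μ) *ᶻ N
      lemma = ℤ-Solver.solve-∀

    power-3-χ : ∀ x → power 3 χ x ≋ R *ᶻ δ ε x [mod 3 ]
    power-3-χ x = ≋-+-cancelʳ (- R *ᶻ δ ε x) (≋-trans (≋-reflexive (sym split))
      (≋-trans (power-3-shifted x) (≋-reflexive (lemma R (δ ε x)))))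
      where
      open ≡-Reasoning
      lemma : ∀ r d → 0ℤ ≡ r *ᶻ d +ᶻ - r *ᶻ d
      lemma = ℤ-Solver.solve-∀
      split : power 3 shifted x ≡ power 3 χ x +ᶻ - R *ᶻ δ ε x
      split = begin
        (∑ λ d → (χ d +ᶻ - R *ᶻ δ ε d) *ᶻ δ (3 • d) x)
          ≡⟨ (∑-cong λ d → distrib (χ d) (- R) (δ ε d) (δ (3 • d) x)) ⟩
        (∑ λ d → χ d *ᶻ δ (3 • d) x +ᶻ - R *ᶻ (δ ε d *ᶻ δ (3 • d) x))
          ≡⟨ ∑-distrib-+ _ _ ⟩
        power 3 χ x +ᶻ (∑ λ d → - R *ᶻ (δ ε d *ᶻ δ (3 • d) x))
          ≡⟨ cong (power 3 χ x +ᶻ_) (trans (∑-*ˡ (- R) _) (cong (- R *ᶻ_) (trans (∑-δ ε (λ d → δ (3 • d) x))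
                (cong (λ y → δ y x) (•-ε 3))))) ⟩
        power 3 χ x +ᶻ - R *ᶻ δ ε x ∎
        where
        distrib : ∀ c r e d → (c +ᶻ r *ᶻ e) *ᶻ d ≡ c *ᶻ d +ᶻ r *ᶻ (e *ᶻ d)
        distrib = ℤ-Solver.solve-∀

    -- Sort the elements d with `9 • d ≡ ε` by x = `3 • d`. Modulo 3 the number of d in D above a
    -- given x is zero unless x = `ε`, where it is r.
    ∣D∩T∣≋r : ∑ (λ d → χ d *ᶻ 𝟙 (9 • d ≟ ε)) ≋ R [mod 3 ]
    ∣D∩T∣≋r = ≋-trans (≋-reflexive (begin
        (∑ λ d → χ d *ᶻ δ (9 • d) ε)
          ≡⟨ (∑-cong λ d → cong (λ y → χ d *ᶻ δ y ε) (sym (•-assoc d 3 3))) ⟩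
        (∑ λ d → χ d *ᶻ δ (3 • (3 • d)) ε)
          ≡⟨ (∑-cong λ d → trans (cong (χ d *ᶻ_) (sym (∑-δ (3 • d) (λ x → δ (3 • x) ε)))) (trans (sym (∑-*ˡ
                (χ d) _)) (∑-cong λ x → sym (ℤₚ.*-assoc (χ d) _ _)))) ⟩
        (∑ λ d → ∑ λ x → χ d *ᶻ δ (3 • d) x *ᶻ δ (3 • x) ε)
          ≡⟨ trans (∑-comm _) (∑-cong λ x → ∑-*ʳ (δ (3 • x) ε) _) ⟩
        (∑ λ x → power 3 χ x *ᶻ δ (3 • x) ε) ∎))
      (≋-trans (∑-≋ λ x → ≋-* (power-3-χ x) (≋-refl {a = δ (3 • x) ε}))
      (≋-reflexive (begin
        (∑ λ x → R *ᶻ δ ε x *ᶻ δ (3 • x) ε)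
          ≡⟨ trans (∑-cong λ x → ℤₚ.*-assoc R _ _) (∑-*ˡ R _) ⟩
        (R *ᶻ ∑ λ x → δ ε x *ᶻ δ (3 • x) ε)
          ≡⟨ cong (R *ᶻ_) (trans (∑-δ ε (λ x → δ (3 • x) ε)) (𝟙-yes (3 • ε ≟ ε) (•-ε 3))) ⟩
        R *ᶻ 1ℤ
          ≡⟨ ℤₚ.*-identityʳ R ⟩
        R ∎)))
      where open ≡-Reasoning

-- Coprimality, and counting by equivalence classes of equal size.

prime∤⇒coprime : ∀ {p a} → Prime p → ¬ p ℕ∣.∣ a → Coprime a p
prime∤⇒coprime pr p∤a {d} (d∣a , d∣p) with prime⇒irreducible pr d∣p
... | inj₁ d≡1  = d≡1
... | inj₂ refl = contradiction d∣a p∤a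

coprime-* : ∀ {a b c} → Coprime a b → Coprime a c → Coprime a (b * c)
coprime-* ab ac (d∣a , d∣bc) = ac (d∣a , coprime-divisor (λ (i , j) → ab (ℕ∣.∣-trans i d∣a , j)) d∣bc)

coprime-^ : ∀ {a b} m → Coprime a b → Coprime a (b ^ m)
coprime-^ zero    ab = λ (_ , d∣1) → ℕ∣.∣1⇒≡1 d∣1
coprime-^ (suc m) ab = coprime-* ab (coprime-^ m ab)

#_ : {P : Fin n → Set} → (∀ x → Dec (P x)) → ℕ
# P? = length (filter P? (allFin _))

#-∑ : {P : Fin n → Set} (P? : ∀ x → Dec (P x)) → + (# P?) ≡ ∑ λ x → 𝟙 (P? x)
#-∑ P? = length-filter-tabulate P? (λ x → x)

module Classes {R : Fin n → Fin n → Set} (R? : ∀ x y → Dec (R x y))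
  (R-refl : ∀ x → R x x) (R-sym : ∀ {x y} → R x y → R y x) (R-trans : ∀ {x y z} → R x y → R y z → R x z)
  (M : ℕ) where

  private
    -- Scan `Fin n` upwards, with X contained in the elements from position j on. If the element at
    -- position j lies in X, its whole class is removed, which costs M elements and leaves the
    -- remaining classes intact.
    go : ∀ d j → d + j ≡ n → {X : Fin n → Set} (X? : ∀ x → Dec (X x)) → (∀ {x} → X x → j ≤ toℕ x) →
      (∀ {x} → X x → (∑ λ y → 𝟙 (X? y ×-dec R? x y)) ≡ + M) → (∑ λ x → 𝟙 (X? x)) ≋ 0ℤ [mod M ]
    go zero j refl X? low cls = ≋-reflexive (∑-zero λ x → 𝟙-no (X? x) λ Xx → ℕₚ.<⇒≱ (toℕ<n x) (low Xx))
    go (suc d) j refl {X} X? low cls = split (X? i)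
      where
      j<n : j < suc d + j
      j<n = s≤s (ℕₚ.m≤n+m j d)
      i : Fin n
      i = fromℕ< j<n
      low′ : ∀ {x} → X x → x ≢ i → suc j ≤ toℕ x
      low′ Xx x≢i = ℕₚ.≤∧≢⇒< (low Xx) λ e → x≢i (toℕ-injective (trans (sym e) (sym (toℕ-fromℕ< j<n))))

      split : Dec (X i) → (∑ λ x → 𝟙 (X? x)) ≋ 0ℤ [mod M ]
      split (no ¬Xi) = go d (suc j) (ℕₚ.+-suc d j) X? (λ Xx → low′ Xx λ { refl → ¬Xi Xx }) cls
      split (yes Xi) = ≋-trans (≋-reflexive (trans (∑-cong λ x → partition (X? x) (R? i x)) (∑-distrib-+ _ _)))
          (≋-+ {b = 0ℤ} (by 1ℤ (trans (cls Xi) (lemma (+ M)))) (go d (suc j) (ℕₚ.+-suc d j) X′?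
            (λ (Xx , ¬Rix) → low′ Xx λ { refl → ¬Rix (R-refl i) })
            λ {x} (Xx , ¬Rix) → trans (∑-cong λ y → 𝟙-cong (X′? y ×-dec R? x y) (X? y ×-dec R? x y)
              (λ ((Xy , _) , Rxy) → Xy , Rxy)
              (λ (Xy , Rxy) → (Xy , λ Riy → ¬Rix (R-trans Riy (R-sym Rxy))) , Rxy)) (cls Xx)))
        where
        X′? : ∀ x → Dec (X x × ¬ R i x)
        X′? x = X? x ×-dec ¬? (R? i x)
        lemma : ∀ m → m ≡ 0ℤ +ᶻ 1ℤ *ᶻ m
        lemma = ℤ-Solver.solve-∀
        partition : {A B : Set} (a : Dec A) (b : Dec B) → 𝟙 a ≡ 𝟙 (a ×-dec b) +ᶻ 𝟙 (a ×-dec ¬? b)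
        partition (yes _) (yes _) = refl
        partition (yes _) (no _)  = refl
        partition (no _)  (yes _) = refl
        partition (no _)  (no _)  = refl

  equal-classes : {X : Fin n → Set} (X? : ∀ x → Dec (X x)) →
    (∀ {x} → X x → (∑ λ y → 𝟙 (X? y ×-dec R? x y)) ≡ + M) → (∑ λ x → 𝟙 (X? x)) ≋ 0ℤ [mod M ]
  equal-classes X? = go n 0 (ℕₚ.+-identityʳ n) X? (λ _ → z≤n)

-- Torsion subgroups and Cauchy's theorem.

module Kernel {v : ℕ} (G : FinAbelianGroup v) where
  open GroupFrobenius G

  module _ (m : ℕ) where
    κ? : ∀ x → Dec (m • x ≡ ε)
    κ? x = m • x ≟ ε

    κ : Elem
    κ x = 𝟙 (κ? x)

    #κ : ℕ
    #κ = # κ?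

    -- The fibres of x ↦ `m • x` are translates of its kernel, hence classes of equal size that
    -- exhaust the group.
    #κ∣v : #κ ℕ∣.∣ v
    #κ∣v = ≋0⇒∣ (≋-trans (≋-reflexive (trans (sym (ℤₚ.*-identityʳ (+ v))) (sym (∑-const v 1ℤ))))
      (Classes.equal-classes (λ x y → m • x ≟ m • y) (λ _ → refl) sym trans #κ (λ _ → yes tt)
        λ {x} _ → trans (sym (∑-translate x _)) (trans (∑-cong λ y →
          𝟙-cong (yes tt ×-dec (m • x ≟ m • (x ∙ y))) (κ? y)
            (λ (_ , e) → sym (∙-cancelˡ (m • x) ε (m • y) (trans (identityʳ _) (trans e (•-distrib-∙ x y m)))))
            (λ e → tt , sym (trans (•-distrib-∙ x y m) (trans (cong ((m • x) ∙_) e) (identityʳ _)))))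
          (sym (#-∑ κ?)))))

    κ⊛κ : ∀ x → (κ ⊛ κ) x ≡ ∑ κ *ᶻ κ x +ᶻ 0ℤ
    κ⊛κ x = trans (∑-cong λ a → ∑-cong λ b → step a b)
      (trans (⊛-const κ (κ x) x) (sym (ℤₚ.+-identityʳ _)))
      where
      step : ∀ a b → κ a *ᶻ κ b *ᶻ δ (a ∙ b) x ≡ κ a *ᶻ κ x *ᶻ δ (a ∙ b) x
      step a b with a ∙ b ≟ x
      ... | no _ = trans (ℤₚ.*-zeroʳ (κ a *ᶻ κ b)) (sym (ℤₚ.*-zeroʳ (κ a *ᶻ κ x)))
      ... | yes refl with κ? a
      ...   | no _   = refl
      ...   | yes ma = cong (λ y → 1ℤ *ᶻ y *ᶻ 1ℤ) (𝟙-cong (κ? b) (κ? (a ∙ b)) (trans shift) (trans (sym shift)))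
        where
        shift : m • (a ∙ b) ≡ m • b
        shift = trans (•-distrib-∙ a b m) (trans (cong (_∙ (m • b)) ma) (identityˡ _))

    open Quadratic κ (∑ κ) 0ℤ κ⊛κ

    constant≡0 : ∀ j → constant j ≡ 0ℤ
    constant≡0 zero    = refl
    constant≡0 (suc j) = trans (cong₂ _+ᶻ_ (ℤₚ.*-zeroʳ (∑ κ ^ᶻ j)) (cong (∑ κ *ᶻ_) (constant≡0 j)))
      (trans (ℤₚ.+-identityˡ _) (ℤₚ.*-zeroʳ (∑ κ)))

    -- A subgroup H satisfies H² = |H| H, so for t ≥ 2 dividing |H| the t-th power of H vanishes
    -- modulo t. By `frobenius` its coefficient at `ε` counts, modulo t, the elements of H killed by
    -- t; if `ε` were the only one, 1 ≡ 0 modulo t would follow.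
    cauchy : ∀ {t} → Prime t → t ℕ∣.∣ #κ → ∃[ x ] (x ≢ ε × t • x ≡ ε × m • x ≡ ε)
    cauchy {zero}        pr = contradiction pr ¬prime[0]
    cauchy {suc zero}    pr = contradiction pr ¬prime[1]
    cauchy {t@(suc (suc j))} pr t∣#κ with any? (λ x → ¬? (x ≟ ε) ×-dec ((t • x ≟ ε) ×-dec κ? x))
    ... | yes found = found
    ... | no none   = contradiction (≋0⇒∣ 1≋0) λ t∣1 → contradiction (ℕ∣.∣1⇒≡1 t∣1) λ ()
      where
      power≡1 : power t κ ε ≡ 1ℤ
      power≡1 = trans (∑-cong λ d → trans (sym (𝟙-× (κ? d) (t • d ≟ ε)))
          (trans (𝟙-cong (κ? d ×-dec (t • d ≟ ε)) (ε ≟ d) (to d)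
            (λ { refl → •-ε m , •-ε t })) (sym (ℤₚ.*-identityʳ (δ ε d))))) (∑-δ ε (λ _ → 1ℤ))
        where
        to : ∀ d → (m • d ≡ ε × t • d ≡ ε) → ε ≡ d
        to d (md , td) with d ≟ ε
        ... | yes e = sym e
        ... | no d≢ε = contradiction (d , d≢ε , td , md) none
      1≋0 : + 1 ≋ 0ℤ [mod t ]
      1≋0 = ≋-trans (≋-reflexive (sym power≡1)) (≋-trans (≋-sym (frobenius pr κ ε))
        (≋-trans (≋-reflexive (trans (^-affine (suc j) ε) (trans (cong (∑ κ *ᶻ ∑ κ ^ᶻ j *ᶻ κ ε +ᶻ_)
              (constant≡0 (suc j)))
          (lemma (∑ κ) (∑ κ ^ᶻ j) (κ ε)))))
        (≋-trans (≋-* (≋-trans (≋-reflexive (sym (#-∑ κ?))) (∣⇒≋0 t∣#κ)) (≋-refl {a = ∑ κ ^ᶻ j *ᶻ κ ε}))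
        (≋-reflexive (ℤₚ.*-zeroˡ (∑ κ ^ᶻ j *ᶻ κ ε))))))
        where
        lemma : ∀ a b c → a *ᶻ b *ᶻ c +ᶻ 0ℤ ≡ a *ᶻ (b *ᶻ c)
        lemma = ℤ-Solver.solve-∀

-- Teichmüller representatives and Chinese-remainder idempotents.

∣m+n∣n⇒∣m : ∀ {d m n} → d ℕ∣.∣ m + n → d ℕ∣.∣ n → d ℕ∣.∣ m
∣m+n∣n⇒∣m {d} {m} {n} h = ℕ∣.∣m+n∣m⇒∣n (subst (d ℕ∣.∣_) (ℕₚ.+-comm m n) h)

second-order : ∀ n c y → ∃[ w ] (c + y) ^ suc n ≡ c ^ suc n + suc n * (c ^ n * y) + y * y * w
second-order zero c y = 0 , lemma c y
  where
  lemma : ∀ c y → (c + y) * 1 ≡ c * 1 + 1 * (1 * y) + y * y * 0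
  lemma = ℕ-Solver.solve-∀
second-order (suc n) c y with w , e ← second-order n c y =
  c * w + suc n * c ^ n + y * w , trans (cong ((c + y) *_) e) (lemma c y w (c ^ n) n)
  where
  lemma : ∀ c y w x n → (c + y) * (c * x + suc n * (x * y) + y * y * w)
    ≡ c * (c * x) + suc (suc n) * (c * x * y) + y * y * (c * w + suc n * x + y * w)
  lemma = ℕ-Solver.solve-∀

^-^ : ∀ a p j → a ^ (p * p ^ j) ≡ (a ^ p ^ j) ^ p
^-^ a p j = trans (cong (a ^_) (ℕₚ.*-comm p (p ^ j))) (sym (ℕₚ.^-*-assoc a (p ^ j) p))

-- If b ≡ c (mod p) then b and c have the same Teichmüller representative.
teichmüller : ∀ p .{{_ : NonZero p}} {b c} z → b ≡ c + p * z → ∀ j → ∃[ y ] b ^ p ^ j ≡ c ^ p ^ j + p ^ suc j * y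
teichmüller p@(suc k) {b} {c} z e zero = z , trans (ℕₚ.^-identityʳ b) (trans e
  (cong₂ _+_ (sym (ℕₚ.^-identityʳ c)) (cong (_* z) (sym (ℕₚ.^-identityʳ p)))))
teichmüller p@(suc k) {b} {c} z e (suc j) with teichmüller p z e j
... | y , e′ with second-order k (c ^ p ^ j) (p ^ suc j * y)
-- The linear term gains one factor p from the exponent. The remainder contains the square of
-- `p ^ suc j`, which is `p ^ suc (suc j)` times `p ^ j`.
... | w , e″ = (c ^ p ^ j) ^ k * y + p ^ j * (y * y * w) , (begin
  b ^ p ^ suc j                        ≡⟨ ^-^ b p j ⟩
  (b ^ p ^ j) ^ p                      ≡⟨ cong (_^ p) e′ ⟩
  (c ^ p ^ j + p ^ suc j * y) ^ p      ≡⟨ e″ ⟩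
  (c ^ p ^ j) ^ p + p * ((c ^ p ^ j) ^ k * (p ^ suc j * y)) + p ^ suc j * y * (p ^ suc j * y) * w
    ≡⟨ lemma p (p ^ j) ((c ^ p ^ j) ^ p) ((c ^ p ^ j) ^ k) y w ⟩
  (c ^ p ^ j) ^ p + p ^ suc (suc j) * ((c ^ p ^ j) ^ k * y + p ^ j * (y * y * w))
    ≡⟨ cong (_+ p ^ suc (suc j) * ((c ^ p ^ j) ^ k * y + p ^ j * (y * y * w))) (^-^ c p j) ⟨
  c ^ p ^ suc j + p ^ suc (suc j) * ((c ^ p ^ j) ^ k * y + p ^ j * (y * y * w)) ∎)
  where
  open ≡-Reasoning
  lemma : ∀ p q c d y w → c + p * (d * (p * q * y)) + p * q * y * (p * q * y) * w
    ≡ c + p * (p * q) * (d * y + q * (y * y * w))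
  lemma = ℕ-Solver.solve-∀

inverse-mod : ∀ {p a} → Prime p → Coprime a p → ∃[ b ] ∃[ z ] b * a ≡ 1 + p * z
inverse-mod {zero}        pr = contradiction pr ¬prime[0]
inverse-mod {suc zero}    pr = contradiction pr ¬prime[1]
inverse-mod {p@(suc (suc k))} {a} pr co with coprime-Bézout co
... | Bézout.+- i j e = i , j , trans (sym e) (cong suc (ℕₚ.*-comm j p))
-- Here i a ≡ -1 modulo p, so i is multiplied by p - 1, which is `suc k`.
... | Bézout.-+ i (suc j) e = i * suc k , k + j * suc k , ℕₚ.+-cancelʳ-≡ (suc k) _ _ (begin
  i * suc k * a + suc k                ≡⟨ lemma₁ i k a ⟩
  (1 + i * a) * suc k                  ≡⟨ cong (_* suc k) e ⟩
  suc j * p * suc k                    ≡⟨ lemma₂ j k ⟩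
  1 + p * (k + j * suc k) + suc k      ∎)
  where
  open ≡-Reasoning
  lemma₁ : ∀ i k a → i * suc k * a + suc k ≡ (1 + i * a) * suc k
  lemma₁ = ℕ-Solver.solve-∀
  lemma₂ : ∀ j k → suc j * suc (suc k) * suc k ≡ 1 + suc (suc k) * (k + j * suc k) + suc k
  lemma₂ = ℕ-Solver.solve-∀

pos-^ : ∀ a n → + (a ^ n) ≡ (+ a) ^ᶻ n
pos-^ a zero    = refl
pos-^ a (suc n) = trans (ℤₚ.pos-* a (a ^ n)) (cong (+ a *ᶻ_) (pos-^ a n))

fermat-^ : ∀ {p} → Prime p → ∀ a j → + (a ^ p ^ j) ≋ + a [mod p ]
fermat-^ pr a zero    = ≋-reflexive (cong +_ (ℕₚ.^-identityʳ a))
fermat-^ {p} pr a (suc j) = ≋-trans (≋-reflexive (trans (cong +_ (^-^ a p j)) (pos-^ (a ^ p ^ j) p)))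
  (≋-trans (fermat pr (+ (a ^ p ^ j))) (fermat-^ pr a j))

-- Used as exponents in a group of order a b with a and b coprime, `e` projects to the part killed
-- by a and `e′` to the part killed by b.
record Idempotents (a b : ℕ) : Set where
  field
    e e′ quotient  : ℕ
    e+e′           : e + e′ ≡ 1 + quotient * (a * b)
    b∣e            : b ℕ∣.∣ e
    a∣e′           : a ℕ∣.∣ e′

idempotents : ∀ {a b} → Coprime a b → .{{_ : NonZero (a * b)}} → Idempotents a b
idempotents {a} {b} co with a * b in ab | coprime-Bézout co
-- The integral choice for `e` would be -j b. Since `suc k` is a b, the natural number j b k is
-- congruent to it modulo a b.
... | suc k | Bézout.+- i j eq = record
  { e = j * b * k ; e′ = i * a ; quotient = j * b
  ; e+e′ = trans (cong (λ y → j * b * k + y) (sym eq)) (trans (lemma (j * b) k) (cong (λ y → 1 + j * b * y) (sym ab)))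
  ; b∣e = ℕ∣.∣m⇒∣m*n k (ℕ∣.n∣m*n j) ; a∣e′ = ℕ∣.n∣m*n i }
  where
  lemma : ∀ x k → x * k + (1 + x) ≡ 1 + x * suc k
  lemma = ℕ-Solver.solve-∀
... | suc k | Bézout.-+ i j eq = record
  { e = j * b ; e′ = i * a * k ; quotient = i * a
  ; e+e′ = trans (cong (λ y → y + i * a * k) (sym eq)) (trans (lemma (i * a) k) (cong (λ y → 1 + i * a * y) (sym ab)))
  ; b∣e = ℕ∣.n∣m*n j ; a∣e′ = ℕ∣.∣m⇒∣m*n k (ℕ∣.n∣m*n i) }
  where
  lemma : ∀ x k → 1 + x + x * k ≡ 1 + x * suc k
  lemma = ℕ-Solver.solve-∀

-- The free action of p - 1 exponents outside the Sylow 3-subgroup.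

module Action {v k m : ℕ} (G : FinAbelianGroup v) (pr : Prime (suc k))
  (co : Coprime 9 (suc k)) (v≡ : v ≡ 9 * suc k ^ suc m) where
  open GroupFrobenius G

  p Q : ℕ
  p = suc k
  Q = p ^ suc m

  co-Q : Coprime 9 Q
  co-Q = coprime-^ (suc m) co

  instance
    nonZero-9*Q : NonZero (9 * Q)
    nonZero-9*Q = ℕₚ.m*n≢0 9 Q {{_}} {{ℕₚ.m^n≢0 p (suc m)}}

  open Idempotents (idempotents co-Q) renaming (e to u; e′ to u′; b∣e to Q∣u; a∣e′ to 9∣u′; e+e′ to u+u′) public

  9Q•≡ε : ∀ x → (9 * Q) • x ≡ ε
  9Q•≡ε x = trans (cong (_• x) (sym v≡)) (order•≡ε x)

  ∣⇒•≡ε : ∀ {a b x} → a ℕ∣.∣ b → a • x ≡ ε → b • x ≡ ε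
  ∣⇒•≡ε {a} (ℕ∣.divides q refl) = •-∣ q a

  •-comm : ∀ a b x → a • (b • x) ≡ b • (a • x)
  •-comm a b x = trans (•-assoc x a b) (trans (cong (_• x) (ℕₚ.*-comm a b)) (sym (•-assoc x b a)))

  9•u : ∀ x → 9 • (u • x) ≡ ε
  9•u x = trans (•-assoc x 9 u) (∣⇒•≡ε (ℕ∣.*-monoʳ-∣ 9 Q∣u) (9Q•≡ε x))

  Q•u′ : ∀ x → Q • (u′ • x) ≡ ε
  Q•u′ x = trans (•-assoc x Q u′) (∣⇒•≡ε
    (ℕ∣.∣-trans (ℕ∣.∣-reflexive (ℕₚ.*-comm 9 Q)) (ℕ∣.*-monoʳ-∣ Q 9∣u′)) (9Q•≡ε x))

  decompose : ∀ x → (u • x) ∙ (u′ • x) ≡ x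
  decompose x = trans (sym (•-homo-+ x u u′)) (trans (cong (_• x) u+u′)
    (trans (cong (x ∙_) (•-∣ quotient (9 * Q) (9Q•≡ε x))) (identityʳ x)))

  u′•-T : ∀ {x} → 9 • x ≡ ε → u′ • x ≡ ε
  u′•-T = ∣⇒•≡ε 9∣u′

  u•-T : ∀ {x} → 9 • x ≡ ε → u • x ≡ x
  u•-T {x} e = trans (sym (identityʳ _)) (trans (cong ((u • x) ∙_) (sym (u′•-T e))) (decompose x))

  u•-P : ∀ {x} → Q • x ≡ ε → u • x ≡ ε
  u•-P = ∣⇒•≡ε Q∣u

  u′•-P : ∀ {x} → Q • x ≡ ε → u′ • x ≡ x
  u′•-P {x} e = trans (sym (identityˡ _)) (trans (cong (_∙ (u′ • x)) (sym (u•-P e))) (decompose x))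

  u′•≡ε⇒u• : ∀ {x} → u′ • x ≡ ε → u • x ≡ x
  u′•≡ε⇒u• {x} e = trans (sym (identityʳ _)) (trans (cong ((u • x) ∙_) (sym e)) (decompose x))

  -- Fixes the 3-part `u • x` and raises the p-part `u′ • x` to the exponent `a ^ Q`. By
  -- `teichmüller` this exponent depends modulo Q only on a modulo p, so the nonzero residues modulo
  -- p act as a group.
  φ : ℕ → Fin v → Fin v
  φ a x = (u • x) ∙ (a ^ Q • (u′ • x))

  Q•a•u′ : ∀ a x → Q • (a • (u′ • x)) ≡ ε
  Q•a•u′ a x = trans (•-comm Q a _) (trans (cong (a •_) (Q•u′ x)) (•-ε a))

  u•φ : ∀ a x → u • φ a x ≡ u • x
  u•φ a x = trans (•-distrib-∙ _ _ u) (trans (cong₂ _∙_ (u•-T (9•u x)) (u•-P (Q•a•u′ (a ^ Q) x))) (identityʳ _))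

  u′•φ : ∀ a x → u′ • φ a x ≡ a ^ Q • (u′ • x)
  u′•φ a x = trans (•-distrib-∙ _ _ u′) (trans (cong₂ _∙_ (u′•-T (9•u x)) (u′•-P (Q•a•u′ (a ^ Q) x))) (identityˡ _))

  φ-1 : ∀ x → φ 1 x ≡ x
  φ-1 x = trans (cong (λ y → (u • x) ∙ y) (trans (cong (_• (u′ • x)) (ℕₚ.^-zeroˡ Q)) (•-homo-1 _))) (decompose x)

  φ-mod : ∀ {b c} z → b ≡ c + p * z → ∀ x → φ b x ≡ φ c x
  φ-mod {b} {c} z e x with teichmüller p z e (suc m)
  ... | y , e′ = cong ((u • x) ∙_) (begin
    b ^ Q • (u′ • x)                              ≡⟨ cong (_• (u′ • x)) e′ ⟩
    (c ^ Q + p * Q * y) • (u′ • x)                ≡⟨ •-homo-+ _ (c ^ Q) (p * Q * y) ⟩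
    (c ^ Q • (u′ • x)) ∙ ((p * Q * y) • (u′ • x))
      ≡⟨ cong ((c ^ Q • (u′ • x)) ∙_) (∣⇒•≡ε {Q} (ℕ∣.∣m⇒∣m*n y (ℕ∣.n∣m*n p)) (Q•u′ x)) ⟩
    (c ^ Q • (u′ • x)) ∙ ε                        ≡⟨ identityʳ _ ⟩
    c ^ Q • (u′ • x)                              ∎)
    where open ≡-Reasoning

  ^-distrib-* : ∀ a b n → (a * b) ^ n ≡ a ^ n * b ^ n
  ^-distrib-* a b zero    = refl
  ^-distrib-* a b (suc n) = trans (cong (a * b *_) (^-distrib-* a b n)) (lemma a b (a ^ n) (b ^ n))
    where
    lemma : ∀ a b x y → a * b * (x * y) ≡ a * x * (b * y)
    lemma = ℕ-Solver.solve-∀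

  φ-∘ : ∀ a b x → φ a (φ b x) ≡ φ (a * b) x
  φ-∘ a b x = cong₂ _∙_ (u•φ b x) (trans (cong (a ^ Q •_) (u′•φ b x))
    (trans (•-assoc _ (a ^ Q) (b ^ Q)) (cong (_• (u′ • x)) (sym (^-distrib-* a b Q)))))

  unit : Fin k → ℕ
  unit i = suc (toℕ i)

  p∤unit : ∀ i → ¬ p ℕ∣.∣ unit i
  p∤unit i d = ℕₚ.<⇒≱ (s≤s (toℕ<n i)) (ℕ∣.∣⇒≤ d)

  reduce : ∀ b → ¬ p ℕ∣.∣ b → ∃[ i ] ∀ x → φ b x ≡ φ (unit i) x
  reduce b p∤b with b % p in eq | m≡m%n+[m/n]*n b p | m%n<n b p
  ... | zero  | e | _ = contradiction (ℕ∣.divides (b / p) e) p∤b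
  ... | suc r | e | s≤s r<k = fromℕ< r<k , φ-mod (b / p)
    (trans e (cong₂ _+_ (cong suc (sym (toℕ-fromℕ< r<k))) (ℕₚ.*-comm (b / p) p)))

  _~_ : Fin v → Fin v → Set
  x ~ y = ∃[ i ] φ (unit i) x ≡ y

  _~?_ : ∀ x y → Dec (x ~ y)
  x ~? y = any? λ i → φ (unit i) x ≟ y

  from-φ : ∀ b → ¬ p ℕ∣.∣ b → ∀ {x y} → φ b x ≡ y → x ~ y
  from-φ b p∤b {x} e with i , e′ ← reduce b p∤b = i , trans (sym (e′ x)) e

  ~-refl : ∀ x → x ~ x
  ~-refl x = from-φ 1 (λ d → ¬prime[1] (subst Prime (ℕ∣.∣1⇒≡1 d) pr)) (φ-1 x)

  ~-trans : ∀ {x y z} → x ~ y → y ~ z → x ~ z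
  ~-trans {x} (i , e) (j , e′) = from-φ (unit j * unit i) p∤
    (trans (sym (φ-∘ (unit j) (unit i) x)) (trans (cong (φ (unit j)) e) e′))
    where
    p∤ : ¬ p ℕ∣.∣ unit j * unit i
    p∤ d with euclidsLemma (unit j) (unit i) pr d
    ... | inj₁ d′ = p∤unit j d′
    ... | inj₂ d′ = p∤unit i d′

  ~-sym : ∀ {x y} → x ~ y → y ~ x
  ~-sym {x} {y} (i , e) with b , z , eq ← inverse-mod pr (prime∤⇒coprime pr (p∤unit i)) =
    from-φ b p∤b (trans (cong (φ b) (sym e)) (trans (φ-∘ b (unit i) x) (trans (φ-mod z eq x) (φ-1 x))))
    where
    p∤b : ¬ p ℕ∣.∣ b
    p∤b d = ¬prime[1] (subst Prime (ℕ∣.∣1⇒≡1 (∣m+n∣n⇒∣m {n = p * z}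
      (subst (p ℕ∣.∣_) eq (ℕ∣.∣m⇒∣m*n (unit i) d)) (ℕ∣.m∣m*n z))) pr)

  coprime-unit^Q : ∀ i → Coprime (unit i ^ Q) Q
  coprime-unit^Q i = Coprimality.sym (coprime-^ Q (Coprimality.sym
    (coprime-^ (suc m) (prime∤⇒coprime pr (p∤unit i)))))

  u′•φ≢ε : ∀ i {x} → u′ • x ≢ ε → u′ • φ (unit i) x ≢ ε
  u′•φ≢ε i {x} ne e = ne (•-injective (coprime-unit^Q i) (Q•u′ x) (•-ε Q)
    (trans (sym (u′•φ (unit i) x)) (trans e (sym (•-ε (unit i ^ Q))))))

  -- Modulo p the multipliers unit i ^ Q are the residues unit i, so their differences are units.
  φ-distinct : ∀ {a d x} → u′ • x ≢ ε → a + d < p → φ a x ≡ φ (a + d) x → d ≡ 0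
  φ-distinct {a} {zero} ne lt e = refl
  φ-distinct {a} {suc d} {x} ne lt e = contradiction
    (•-injective (coprime-^ (suc m) (prime∤⇒coprime pr p∤D)) (Q•u′ x) (•-ε Q) (trans D•≡ε (sym (•-ε D)))) ne
    where
    D : ℕ
    D = (a + suc d) ^ Q ∸ a ^ Q
    split : a ^ Q + D ≡ (a + suc d) ^ Q
    split = ℕₚ.m+[n∸m]≡n (ℕₚ.^-monoˡ-≤ Q (ℕₚ.m≤m+n a (suc d)))
    D•≡ε : D • (u′ • x) ≡ ε
    D•≡ε = ∙-cancelˡ (a ^ Q • (u′ • x)) _ _ (trans (sym (•-homo-+ _ (a ^ Q) D))
      (trans (cong (_• (u′ • x)) split) (trans (sym (∙-cancelˡ (u • x) _ _ e)) (sym (identityʳ _)))))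
    D≋ : + D ≋ + suc d [mod p ]
    D≋ = ≋-+-cancelʳ (+ a) (≋-trans (≋-+ (≋-refl {a = + D}) (≋-sym (fermat-^ pr a (suc m))))
      (≋-trans (≋-reflexive (cong +_ (trans (ℕₚ.+-comm D (a ^ Q)) split)))
      (≋-trans (fermat-^ pr (a + suc d) (suc m)) (≋-reflexive (cong +_ (ℕₚ.+-comm a (suc d)))))))
    p∤D : ¬ p ℕ∣.∣ D
    p∤D p∣D = ℕₚ.<⇒≱ (ℕₚ.≤-<-trans (ℕₚ.m≤n+m (suc d) a) lt)
      (ℕ∣.∣⇒≤ (≋0⇒∣ (≋-trans (≋-sym D≋) (∣⇒≋0 p∣D))))

  φ-injective : ∀ {x} → u′ • x ≢ ε → ∀ {i j} → φ (unit i) x ≡ φ (unit j) x → i ≡ j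
  φ-injective {x} ne {i} {j} e with ℕₚ.≤-total (unit i) (unit j)
  ... | inj₁ i≤j = toℕ-injective (ℕₚ.suc-injective (trans (sym (ℕₚ.+-identityʳ _)) (trans (cong (λ d → unit i + d)
        (sym (φ-distinct {unit i} {unit j ∸ unit i} ne (subst (_< p) (sym eq) (s≤s (toℕ<n j)))
          (trans e (cong (λ b → φ b x) (sym eq)))))) eq)))
    where eq = ℕₚ.m+[n∸m]≡n i≤j
  ... | inj₂ j≤i = sym (toℕ-injective (ℕₚ.suc-injective (trans (sym (ℕₚ.+-identityʳ _)) (trans (cong
        (λ d → unit j + d)
        (sym (φ-distinct {unit j} {unit i ∸ unit j} ne (subst (_< p) (sym eq) (s≤s (toℕ<n i)))
          (trans (sym e) (cong (λ b → φ b x) (sym eq)))))) eq))))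
    where eq = ℕₚ.m+[n∸m]≡n j≤i

  -- The condition `u′ • x ≢ ε` says that x has a nontrivial p-part, that is, lies off T. There the
  -- residues 1, ..., p - 1 give distinct images by `φ-injective`, so the orbits in X have exactly k
  -- = p - 1 elements.
  orbits : {X : Fin v → Set} (X? : ∀ x → Dec (X x)) → (∀ {x} → X x → u′ • x ≢ ε) →
    (∀ i {x} → X x → X (φ (unit i) x)) → (∑ λ x → 𝟙 (X? x)) ≋ 0ℤ [mod k ]
  orbits {X} X? free closed = Classes.equal-classes _~?_ ~-refl ~-sym ~-trans k X? λ {x} Xx → begin
    (∑ λ y → 𝟙 (X? y ×-dec (x ~? y)))         ≡⟨ ∑-cong (λ y → orbit Xx y) ⟩
    (∑ λ y → ∑ λ i → δ (φ (unit i) x) y)      ≡⟨ ∑-comm _ ⟩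
    (∑ λ i → ∑ λ y → δ (φ (unit i) x) y)
      ≡⟨ (∑-cong λ i → trans (∑-cong λ y → sym (ℤₚ.*-identityʳ _)) (∑-δ (φ (unit i) x) (λ _ → 1ℤ))) ⟩
    (∑ λ (i : Fin k) → 1ℤ)                    ≡⟨ trans (∑-const k 1ℤ) (ℤₚ.*-identityʳ (+ k)) ⟩
    + k                                       ∎
    where
    open ≡-Reasoning
    orbit : ∀ {x} → X x → ∀ y → 𝟙 (X? y ×-dec (x ~? y)) ≡ ∑ λ i → δ (φ (unit i) x) y
    orbit {x} Xx y with X? y ×-dec (x ~? y)
    ... | yes (_ , i , refl) = sym (trans (∑-cong λ j → trans
            (𝟙-cong (φ (unit j) x ≟ φ (unit i) x) (i ≟ j) (λ e → sym (φ-injective (free Xx) e)) (λ { refl → refl }))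
            (sym (ℤₚ.*-identityʳ _))) (∑-δ i (λ _ → 1ℤ)))
    ... | no ¬r = sym (∑-zero λ i → 𝟙-no (φ (unit i) x ≟ y) λ { refl → ¬r (closed i Xx , i , refl) })

  -- Realises `φ a` as a single power map, so that `D-multiplier` applies to it. The exponent is 1
  -- modulo 9 and `a ^ Q` modulo Q.
  multiplier-of : ℕ → ℕ
  multiplier-of a = u + u′ * a ^ Q

  φ≡• : ∀ a x → φ a x ≡ multiplier-of a • x
  φ≡• a x = sym (trans (•-homo-+ x u (u′ * a ^ Q)) (cong ((u • x) ∙_)
    (trans (cong (_• x) (ℕₚ.*-comm u′ (a ^ Q))) (sym (•-assoc x (a ^ Q) u′)))))

  p∣Q : p ℕ∣.∣ Q
  p∣Q = ℕ∣.m∣m*n (p ^ m)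

  ∤u+u′ : ∀ {d} → d ℕ∣.∣ 9 * Q → d ℕ∣.∣ u + u′ → d ≡ 1
  ∤u+u′ {d} d∣v d∣u+u′ = ℕ∣.∣1⇒≡1 (∣m+n∣n⇒∣m {n = quotient * (9 * Q)} (subst (d ℕ∣.∣_) u+u′ d∣u+u′)
        (ℕ∣.∣n⇒∣m*n quotient d∣v))

  -- As u + u′ ≡ 1 modulo 9 Q, the prime p divides u but not u′, while 9 divides u′ and no
  -- nontrivial divisor of 9 divides u.
  coprime-multiplier : ∀ i → Coprime (multiplier-of (unit i)) v
  coprime-multiplier i = subst (Coprime _) (sym v≡) (coprime-* co-9 (coprime-^ (suc m) (prime∤⇒coprime pr p∤)))
    where
    p∤ : ¬ p ℕ∣.∣ multiplier-of (unit i)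
    p∤ d with euclidsLemma u′ (unit i ^ Q) pr (ℕ∣.∣m+n∣m⇒∣n d (ℕ∣.∣-trans p∣Q Q∣u))
    ... | inj₁ p∣u′ = ¬prime[1] (subst Prime (∤u+u′ (ℕ∣.∣n⇒∣m*n 9 p∣Q)
            (ℕ∣.∣m∣n⇒∣m+n (ℕ∣.∣-trans p∣Q Q∣u) p∣u′)) pr)
    ... | inj₂ p∣^ = ¬prime[1] (subst Prime (coprime-unit^Q i (p∣^ , p∣Q)) pr)
    co-9 : Coprime (multiplier-of (unit i)) 9
    co-9 {d} (d∣w , d∣9) = ∤u+u′ (ℕ∣.∣m⇒∣m*n Q d∣9) (ℕ∣.∣m∣n⇒∣m+n
      (∣m+n∣n⇒∣m d∣w (ℕ∣.∣m⇒∣m*n (unit i ^ Q) d∣u′)) d∣u′)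
      where
      d∣u′ : d ℕ∣.∣ u′
      d∣u′ = ℕ∣.∣-trans d∣9 9∣u′

-- Intersection with, and projection to, the Sylow 3-subgroup.

#≡0⇒¬ : ∀ {n} {P : Fin n → Set} (P? : ∀ x → Dec (P x)) → # P? ≡ 0 → ∀ {x} → ¬ P x
#≡0⇒¬ {n} P? e {x} Px with filter P? (allFin n) | ∈-filter⁺ P? (∈-allFin x) Px
#≡0⇒¬ P? () Px | _ ∷ _ | _

≋-∣ : ∀ {a b k d} → d ℕ∣.∣ k → a ≋ b [mod k ] → a ≋ b [mod d ]
≋-∣ {a} {b} {d = d} (ℕ∣.divides e refl) (by q eq) = by (q *ᶻ + e)
  (trans eq (cong (b +ᶻ_) (trans (cong (q *ᶻ_) (ℤₚ.pos-* e d)) (sym (ℤₚ.*-assoc q (+ e) (+ d))))))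

module Projection {v r n k m : ℕ} (G : FinAbelianGroup v) (D : Subset v)
  (pr : Prime (suc k)) (co : Coprime 9 (suc k)) (v≡9Q : v ≡ 9 * suc k ^ suc m)
  (v≡n² : v ≡ n * n) (2r≢n : r + r ≢ n)
  (pds : IsPDS G D (r * (n + 1)) (- + n +ᶻ + (r * r + 3 * r)) (+ (r * r + r))) where
  open PDS {r = r} {n = n} G D v≡n² 2r≢n pds
  open Action {m = m} G pr co v≡9Q
  open Kernel G

  φ-closed : ∀ i {x} → x ∈ D → φ (unit i) x ∈ D
  φ-closed i {x} x∈D = subst (_∈ D) (sym (φ≡• (unit i) x))
    (D-multiplier (multiplier-of (unit i)) {{multiplier≢0}} (coprime-multiplier i) x∈D)
    where
    multiplier≢0 : NonZero (multiplier-of (unit i))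
    multiplier≢0 = ≢-nonZero λ e → ℕₚ.<⇒≢ (ℕₚ.≤-trans (s≤s (s≤s z≤n)) (ℕₚ.≤-trans (ℕₚ.m≤m*n 9 Q {{ℕₚ.m^n≢0
          (suc k) (suc m)}}) (ℕₚ.≤-reflexive (sym v≡9Q))))
      (sym (coprime-multiplier i (subst (v ℕ∣.∣_) (sym e) (v ℕ∣.∣0) , ℕ∣.∣-refl)))

  T? : ∀ x → Dec (9 • x ≡ ε)
  T? = κ? 9

  T : Elem
  T = κ 9

  u′⇒T : ∀ {x} → u′ • x ≡ ε → 9 • x ≡ ε
  u′⇒T {x} e = trans (cong (9 •_) (sym (u′•≡ε⇒u• e))) (9•u x)

  χT : ℤ
  χT = ∑ λ d → χ d *ᶻ T d

  ∣D∣≋∣D∩T∣ : ∑ χ ≋ χT [mod k ]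
  ∣D∣≋∣D∩T∣ = ≋-trans (≋-reflexive (trans (∑-cong partition) (∑-distrib-+ _ _)))
    (≋-trans (≋-+ (orbits X? proj₂ (λ i (x∈D , ne) → φ-closed i x∈D , u′•φ≢ε i ne)) ≋-refl)
    (≋-reflexive (ℤₚ.+-identityˡ χT)))
    where
    X? : ∀ x → Dec (x ∈ D × u′ • x ≢ ε)
    X? x = x ∈? D ×-dec ¬? (u′ • x ≟ ε)
    partition : ∀ d → χ d ≡ 𝟙 (X? d) +ᶻ χ d *ᶻ T d
    partition d with d ∈? D | u′ • d ≟ ε
    ... | no _  | yes _ = refl
    ... | no _  | no _  = refl
    ... | yes _ | yes e = sym (trans (ℤₚ.+-identityˡ _) (trans (ℤₚ.*-identityˡ _) (𝟙-yes (T? d) (u′⇒T e))))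
    ... | yes _ | no ne = sym (cong (λ y → 1ℤ +ᶻ 1ℤ *ᶻ y) (𝟙-no (T? d) λ e → ne (u′•-T e)))

  -- The image under G → T, extended by zero to all of G so that products can still be formed with
  -- the same `⊛`. The coefficient at t sums f over the coset of the Sylow p-subgroup through t.
  pushforward : Elem → Elem
  pushforward f t = ∑ λ d → f d *ᶻ δ (u • d) t

  -- The action preserves 3-parts, hence each coset of the Sylow p-subgroup. The elements of D in
  -- the coset of t other than t itself fall into free orbits.
  pushforward-χ : ∀ {t} → 9 • t ≡ ε → pushforward χ t ≋ χ t [mod k ]
  pushforward-χ {t} t∈T = ≋-trans (≋-reflexive (trans (∑-cong partition) (∑-distrib-+ _ _)))
    (≋-trans (≋-+ (orbits X? (λ (_ , _ , ne) → ne)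
      (λ i {x} (x∈D , e , ne) → φ-closed i x∈D , trans (u•φ (unit i) x) e , u′•φ≢ε i ne)) ≋-refl)
    (≋-reflexive (trans (ℤₚ.+-identityˡ _) (∑-δʳ t χ))))
    where
    X? : ∀ x → Dec (x ∈ D × u • x ≡ t × u′ • x ≢ ε)
    X? x = x ∈? D ×-dec ((u • x ≟ t) ×-dec ¬? (u′ • x ≟ ε))
    partition : ∀ d → χ d *ᶻ δ (u • d) t ≡ 𝟙 (X? d) +ᶻ χ d *ᶻ δ t d
    partition d with d ∈? D
    ... | no _ = refl
    ... | yes d∈D with u′ • d ≟ ε
    ...   | yes e = trans (cong (1ℤ *ᶻ_) (𝟙-cong (u • d ≟ t) (t ≟ d)
              (λ e′ → trans (sym e′) (u′•≡ε⇒u• e)) (λ e′ → trans (u′•≡ε⇒u• e) (sym e′))))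
            (sym (trans (cong (_+ᶻ 1ℤ *ᶻ δ t d) (𝟙-no (yes d∈D ×-dec ((u • d ≟ t) ×-dec no (λ ne → ne e)))
              λ (_ , _ , ne) → ne e)) (ℤₚ.+-identityˡ _)))
    ...   | no ne = trans (ℤₚ.*-identityˡ _) (sym (trans (cong₂ (λ a b → a +ᶻ 1ℤ *ᶻ b)
              (𝟙-cong (yes d∈D ×-dec ((u • d ≟ t) ×-dec yes ne)) (u • d ≟ t) (λ (_ , e , _) → e) (λ e → d∈D , e , ne))
              (𝟙-no (t ≟ d) λ e → ne (u′•-T (trans (cong (9 •_) (sym e)) t∈T)))) (ℤₚ.+-identityʳ _)))

  D∩T? : ∀ x → Dec (x ∈ D × 9 • x ≡ ε)
  D∩T? x = x ∈? D ×-dec T? x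

  T∖D∖ε? : ∀ x → Dec (9 • x ≡ ε × x ∉ D × x ≢ ε)
  T∖D∖ε? x = T? x ×-dec (¬? (x ∈? D) ×-dec ¬? (x ≟ ε))

  χT≡# : χT ≡ + (# D∩T?)
  χT≡# = trans (∑-cong λ d → sym (𝟙-× (d ∈? D) (T? d))) (sym (#-∑ D∩T?))

  #T : #κ 9 ≡ 1 + (# D∩T? + # T∖D∖ε?)
  #T = ℤₚ.+-injective (begin
    + #κ 9                                                     ≡⟨ #-∑ T? ⟩
    (∑ λ x → T x)                                              ≡⟨ ∑-cong partition ⟩
    (∑ λ x → δ ε x *ᶻ 1ℤ +ᶻ (𝟙 (D∩T? x) +ᶻ 𝟙 (T∖D∖ε? x)))
      ≡⟨ trans (∑-distrib-+ _ _) (cong₂ _+ᶻ_ (∑-δ ε (λ _ → 1ℤ)) (∑-distrib-+ _ _)) ⟩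
    1ℤ +ᶻ ((∑ λ x → 𝟙 (D∩T? x)) +ᶻ (∑ λ x → 𝟙 (T∖D∖ε? x)))     ≡⟨ cong (1ℤ +ᶻ_) (cong₂ _+ᶻ_ (#-∑ D∩T?) (#-∑ T∖D∖ε?)) ⟨
    + (1 + (# D∩T? + # T∖D∖ε?))                                ∎)
    where
    open ≡-Reasoning
    partition : ∀ x → T x ≡ δ ε x *ᶻ 1ℤ +ᶻ (𝟙 (D∩T? x) +ᶻ 𝟙 (T∖D∖ε? x))
    partition x with x ≟ ε
    ... | yes refl = trans (𝟙-yes (T? ε) (•-ε 9)) (sym (cong₂ _+ᶻ_ (cong (_*ᶻ 1ℤ) (δ-refl ε))
          (cong₂ _+ᶻ_ (𝟙-no (D∩T? ε) λ (ε∈D , _) → ε∉D ε∈D)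
            (𝟙-no (T? ε ×-dec (¬? (ε ∈? D) ×-dec ¬? (yes refl))) λ (_ , _ , ne) → ne refl))))
    ... | no x≢ε = trans (split (T? x) (x ∈? D)) (trans (sym (ℤₚ.+-identityˡ _)) (cong (_+ᶻ (𝟙 (D∩T? x) +ᶻ 𝟙
          (T? x ×-dec (¬? (x ∈? D) ×-dec ¬? (no x≢ε)))))
          (sym (cong (_*ᶻ 1ℤ) (𝟙-no (ε ≟ x) λ e → x≢ε (sym e))))))
      where
      split : {A B : Set} (a : Dec A) (b : Dec B) → 𝟙 a ≡ 𝟙 (b ×-dec a) +ᶻ 𝟙 (a ×-dec (¬? b ×-dec ¬? (no x≢ε)))
      split (yes _) (yes _) = refl
      split (yes _) (no _)  = refl
      split (no _)  (yes _) = refl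
      split (no _)  (no _)  = refl

  -- The order of T divides v = 9 Q. It is prime to p, since `cauchy` would otherwise provide a
  -- nontrivial element killed by both p and 9.
  #T∣9 : #κ 9 ℕ∣.∣ 9
  #T∣9 = coprime-divisor (coprime-^ (suc m) (prime∤⇒coprime pr p∤)) (subst (#κ 9 ℕ∣.∣_) (trans v≡9Q
        (ℕₚ.*-comm 9 Q)) (#κ∣v 9))
    where
    p∤ : ¬ suc k ℕ∣.∣ #κ 9
    p∤ d with x , x≢ε , px , 9x ← cauchy 9 pr d =
      x≢ε (•-injective (Coprimality.sym co) 9x (•-ε 9) (trans px (sym (•-ε (suc k)))))

  #D∩T≤8 : # D∩T? + # T∖D∖ε? ≤ 8
  #D∩T≤8 = ℕₚ.≤-pred (subst (_≤ 9) #T (ℕ∣.∣⇒≤ #T∣9))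

  -- Both sides of the relation of shifted² are pushed forward to the Sylow 3-subgroup T;
  -- there they are known modulo k = p − 1, and the constants cancel between two coefficients.
  module Comparison (α : ℤ) (χ-T : ∀ {t} → 9 • t ≡ ε → χ t ≡ α +ᶻ - α *ᶻ δ ε t)
    {t : Fin v} (t≢ε : t ≢ ε) (t∈T : 9 • t ≡ ε) where

    R′ : ℤ
    R′ = R +ᶻ α

    -- `f` is the value of `F` modulo k: on T, χ - r · 1 equals α - (r + α) · 1, and off T both
    -- vanish.
    F f : Elem
    F = pushforward shifted
    f = (λ x → α *ᶻ T x) ⊞ single ε (- R′)

    ∑-pushforward : ∀ g (ψ : Elem) → (∑ λ y → pushforward g y *ᶻ ψ y) ≡ ∑ λ d → g d *ᶻ ψ (u • d)
    ∑-pushforward g ψ = begin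
      (∑ λ y → (∑ λ d → g d *ᶻ δ (u • d) y) *ᶻ ψ y)  ≡⟨ (∑-cong λ y → sym (∑-*ʳ (ψ y) _)) ⟩
      (∑ λ y → ∑ λ d → g d *ᶻ δ (u • d) y *ᶻ ψ y)    ≡⟨ ∑-comm _ ⟩
      (∑ λ d → ∑ λ y → g d *ᶻ δ (u • d) y *ᶻ ψ y)
        ≡⟨ (∑-cong λ d → trans (∑-cong λ y → ℤₚ.*-assoc (g d) _ _) (trans (∑-*ˡ (g d) _) (cong (g d *ᶻ_) (∑-δ
              (u • d) ψ)))) ⟩
      (∑ λ d → g d *ᶻ ψ (u • d))                     ∎
      where open ≡-Reasoning

    pushforward-⊛ : ∀ g h x → pushforward (g ⊛ h) x ≡ (pushforward g ⊛ pushforward h) x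
    pushforward-⊛ g h x = begin
      (∑ λ y → (g ⊛ h) y *ᶻ δ (u • y) x)
        ≡⟨ ∑-⊛ g h (λ y → δ (u • y) x) ⟩
      (∑ λ a → ∑ λ b → g a *ᶻ h b *ᶻ δ (u • (a ∙ b)) x)
        ≡⟨ (∑-cong λ a → trans (∑-cong λ b → trans (ℤₚ.*-assoc (g a) _ _) (cong (λ y → g a *ᶻ (h b *ᶻ δ y x))
              (•-distrib-∙ a b u))) (∑-*ˡ (g a) _)) ⟩
      (∑ λ a → g a *ᶻ ∑ λ b → h b *ᶻ δ ((u • a) ∙ (u • b)) x)
        ≡⟨ (∑-cong λ a → cong (g a *ᶻ_) (∑-pushforward h (λ z → δ ((u • a) ∙ z) x))) ⟨
      (∑ λ a → g a *ᶻ ∑ λ z → pushforward h z *ᶻ δ ((u • a) ∙ z) x)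
        ≡⟨ ∑-pushforward g (λ y → ∑ λ z → pushforward h z *ᶻ δ (y ∙ z) x) ⟨
      (∑ λ y → pushforward g y *ᶻ ∑ λ z → pushforward h z *ᶻ δ (y ∙ z) x)
        ≡⟨ (∑-cong λ y → trans (sym (∑-*ˡ (pushforward g y) _)) (∑-cong λ z → sym (ℤₚ.*-assoc
              (pushforward g y) _ _))) ⟩
      (pushforward g ⊛ pushforward h) x ∎
      where open ≡-Reasoning

    F≡ : ∀ y → F y ≡ pushforward χ y +ᶻ - R *ᶻ δ ε y
    F≡ y = trans (∑-cong λ d → distrib (χ d) (- R) (δ ε d) (δ (u • d) y)) (trans (∑-distrib-+ _ _)
      (cong (pushforward χ y +ᶻ_) (trans (∑-*ˡ (- R) _) (cong (- R *ᶻ_)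
        (trans (∑-δ ε (λ d → δ (u • d) y)) (cong (λ z → δ z y) (•-ε u)))))))
      where
      distrib : ∀ c r e d → (c +ᶻ r *ᶻ e) *ᶻ d ≡ c *ᶻ d +ᶻ r *ᶻ (e *ᶻ d)
      distrib = ℤ-Solver.solve-∀

    F≋f : ∀ y → F y ≋ f y [mod k ]
    F≋f y with T? y
    ... | yes y∈T = ≋-trans (≋-reflexive (F≡ y)) (≋-trans (≋-+ (pushforward-χ y∈T) ≋-refl)
          (≋-reflexive (trans (cong (_+ᶻ - R *ᶻ δ ε y) (χ-T y∈T)) (lemma α R (δ ε y)))))
      where
      lemma : ∀ a r d → a +ᶻ - a *ᶻ d +ᶻ - r *ᶻ d ≡ a *ᶻ 1ℤ +ᶻ - (r +ᶻ a) *ᶻ d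
      lemma = ℤ-Solver.solve-∀
    ... | no y∉T = ≋-reflexive (trans (∑-zero λ d → trans (cong (shifted d *ᶻ_)
            (𝟙-no (u • d ≟ y) λ { refl → y∉T (9•u d) })) (ℤₚ.*-zeroʳ (shifted d)))
          (sym (trans (cong (λ z → α *ᶻ 0ℤ +ᶻ - R′ *ᶻ z) (𝟙-no (ε ≟ y) λ { refl → y∉T (•-ε 9) })) (lemma α (- R′)))))
      where
      lemma : ∀ a r → a *ᶻ 0ℤ +ᶻ r *ᶻ 0ℤ ≡ 0ℤ
      lemma = ℤ-Solver.solve-∀

    f⊛f : ∀ {x} → 9 • x ≡ ε → (f ⊛ f) x ≡ α *ᶻ (α *ᶻ ∑ T +ᶻ - R′) +ᶻ - R′ *ᶻ (α +ᶻ - R′ *ᶻ δ ε x)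
    f⊛f {x} x∈T = begin
      (f ⊛ f) x
        ≡⟨ ⊛-distribˡ f (λ y → α *ᶻ T y) (single ε (- R′)) x ⟩
      (f ⊛ λ y → α *ᶻ T y) x +ᶻ (f ⊛ single ε (- R′)) x
        ≡⟨ cong₂ _+ᶻ_ (trans (⊛-*ʳ f T α x) (cong (α *ᶻ_) (trans (⊛-comm f T x) T⊛f)))
             (trans (⊛-comm f (single ε (- R′)) x) (scalar-⊛ (- R′) f x)) ⟩
      α *ᶻ (α *ᶻ (∑ T *ᶻ T x) +ᶻ - R′ *ᶻ T x) +ᶻ - R′ *ᶻ f x
        ≡⟨ cong (λ z → α *ᶻ (α *ᶻ (∑ T *ᶻ z) +ᶻ - R′ *ᶻ z) +ᶻ - R′ *ᶻ (α *ᶻ z +ᶻ - R′ *ᶻ δ ε x)) (𝟙-yes (T? x) x∈T) ⟩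
      α *ᶻ (α *ᶻ (∑ T *ᶻ 1ℤ) +ᶻ - R′ *ᶻ 1ℤ) +ᶻ - R′ *ᶻ (α *ᶻ 1ℤ +ᶻ - R′ *ᶻ δ ε x)
        ≡⟨ lemma α (∑ T) (- R′) (δ ε x) ⟩
      α *ᶻ (α *ᶻ ∑ T +ᶻ - R′) +ᶻ - R′ *ᶻ (α +ᶻ - R′ *ᶻ δ ε x) ∎
      where
      open ≡-Reasoning
      lemma : ∀ a s r d → a *ᶻ (a *ᶻ (s *ᶻ 1ℤ) +ᶻ r *ᶻ 1ℤ) +ᶻ r *ᶻ (a *ᶻ 1ℤ +ᶻ r *ᶻ d)
        ≡ a *ᶻ (a *ᶻ s +ᶻ r) +ᶻ r *ᶻ (a +ᶻ r *ᶻ d)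
      lemma = ℤ-Solver.solve-∀
      T⊛f : (T ⊛ f) x ≡ α *ᶻ (∑ T *ᶻ T x) +ᶻ - R′ *ᶻ T x
      T⊛f = trans (⊛-distribˡ T (λ y → α *ᶻ T y) (single ε (- R′)) x) (cong₂ _+ᶻ_
        (trans (⊛-*ʳ T T α x) (cong (α *ᶻ_) (trans (κ⊛κ 9 x) (ℤₚ.+-identityʳ _))))
        (trans (⊛-comm T (single ε (- R′)) x) (scalar-⊛ (- R′) T x)))

    -- The order of the kernel of x ↦ `u • x`. It stays symbolic because, being the same over every
    -- point of T, it cancels in `R′²≋NR′`.
    fibre : ℤ
    fibre = ∑ λ x → δ (u • x) ε

    fibre-T : ∀ {x} → 9 • x ≡ ε → (∑ λ y → δ (u • y) x) ≡ fibre
    fibre-T {x} x∈T = trans (sym (∑-translate x _)) (∑-cong λ y → 𝟙-cong (u • (x ∙ y) ≟ x) (u • y ≟ ε)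
      (λ e → ∙-cancelˡ x (u • y) ε (trans (trans (sym (shift y)) e) (sym (identityʳ x))))
      (λ e → trans (shift y) (trans (cong (x ∙_) e) (identityʳ x))))
      where
      shift : ∀ y → u • (x ∙ y) ≡ x ∙ (u • y)
      shift y = trans (•-distrib-∙ x y u) (cong (_∙ (u • y)) (u•-T x∈T))

    F⊛F : ∀ {x} → 9 • x ≡ ε → (F ⊛ F) x ≡ - N *ᶻ F x +ᶻ μ *ᶻ fibre
    F⊛F {x} x∈T = begin
      (F ⊛ F) x
        ≡⟨ pushforward-⊛ shifted shifted x ⟨
      (∑ λ d → (shifted ⊛ shifted) d *ᶻ δ (u • d) x)
        ≡⟨ (∑-cong λ d → trans (cong (_*ᶻ δ (u • d) x) (shifted² d)) (distrib (- N) (shifted d) μ (δ (u • d) x))) ⟩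
      (∑ λ d → - N *ᶻ (shifted d *ᶻ δ (u • d) x) +ᶻ μ *ᶻ δ (u • d) x)
        ≡⟨ trans (∑-distrib-+ _ _) (cong₂ _+ᶻ_ (∑-*ˡ (- N) _) (trans (∑-*ˡ μ _) (cong (μ *ᶻ_) (fibre-T x∈T)))) ⟩
      - N *ᶻ F x +ᶻ μ *ᶻ fibre ∎
      where
      open ≡-Reasoning
      distrib : ∀ n s m d → (n *ᶻ s +ᶻ m) *ᶻ d ≡ n *ᶻ (s *ᶻ d) +ᶻ m *ᶻ d
      distrib = ℤ-Solver.solve-∀

    coefficient : ∀ {x} → 9 • x ≡ ε → (f ⊛ f) x ≋ - N *ᶻ f x +ᶻ μ *ᶻ fibre [mod k ]
    coefficient {x} x∈T = ≋-trans (∑-≋ λ a → ∑-≋ λ b → ≋-* (≋-* (≋-sym (F≋f a)) (≋-sym (F≋f b))) ≋-refl)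
      (≋-trans (≋-reflexive (F⊛F x∈T)) (≋-+ (≋-* (≋-refl {a = - N}) (F≋f x)) ≋-refl))

    coefficient′ : ∀ {x} → 9 • x ≡ ε → α *ᶻ (α *ᶻ ∑ T +ᶻ - R′) +ᶻ - R′ *ᶻ (α +ᶻ - R′ *ᶻ δ ε x)
      ≋ - N *ᶻ (α +ᶻ - R′ *ᶻ δ ε x) +ᶻ μ *ᶻ fibre [mod k ]
    coefficient′ {x} x∈T = ≋-trans (≋-reflexive (sym (f⊛f x∈T))) (≋-trans (coefficient x∈T)
      (≋-reflexive (cong (λ z → - N *ᶻ (z +ᶻ - R′ *ᶻ δ ε x) +ᶻ μ *ᶻ fibre)
        (trans (cong (α *ᶻ_) (𝟙-yes (T? x) x∈T)) (ℤₚ.*-identityʳ α)))))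

    -- Subtracting the coefficient at t from the one at `ε` removes all multiples of T. What remains
    -- is the square of -R′ on the left and -N times -R′ on the right.
    R′²≋NR′ : R′ *ᶻ R′ ≋ N *ᶻ R′ [mod k ]
    R′²≋NR′ = ≋-trans (≋-reflexive (lemma₁ α (∑ T) R′))
      (≋-trans (≋-+ at-ε (≋-* (≋-refl {a = - 1ℤ}) at-t)) (≋-reflexive (lemma₂ N α R′ (μ *ᶻ fibre))))
      where
      at-ε : α *ᶻ (α *ᶻ ∑ T +ᶻ - R′) +ᶻ - R′ *ᶻ (α +ᶻ - R′ *ᶻ 1ℤ) ≋ - N *ᶻ (α +ᶻ - R′ *ᶻ 1ℤ) +ᶻ μ *ᶻ fibre [mod k ]
      at-ε = subst (λ z → α *ᶻ (α *ᶻ ∑ T +ᶻ - R′) +ᶻ - R′ *ᶻ (α +ᶻ - R′ *ᶻ z) ≋ - N *ᶻ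
            (α +ᶻ - R′ *ᶻ z) +ᶻ μ *ᶻ fibre [mod k ])
        (δ-refl ε) (coefficient′ (•-ε 9))
      at-t : α *ᶻ (α *ᶻ ∑ T +ᶻ - R′) +ᶻ - R′ *ᶻ (α +ᶻ - R′ *ᶻ 0ℤ) ≋ - N *ᶻ (α +ᶻ - R′ *ᶻ 0ℤ) +ᶻ μ *ᶻ fibre [mod k ]
      at-t = subst (λ z → α *ᶻ (α *ᶻ ∑ T +ᶻ - R′) +ᶻ - R′ *ᶻ (α +ᶻ - R′ *ᶻ z) ≋ - N *ᶻ
            (α +ᶻ - R′ *ᶻ z) +ᶻ μ *ᶻ fibre [mod k ])
        (𝟙-no (ε ≟ t) λ e → t≢ε (sym e)) (coefficient′ t∈T)
      lemma₁ : ∀ a s r → r *ᶻ r ≡ a *ᶻ (a *ᶻ s +ᶻ - r) +ᶻ - r *ᶻ (a +ᶻ - r *ᶻ 1ℤ)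
        +ᶻ - 1ℤ *ᶻ (a *ᶻ (a *ᶻ s +ᶻ - r) +ᶻ - r *ᶻ (a +ᶻ - r *ᶻ 0ℤ))
      lemma₁ = ℤ-Solver.solve-∀
      lemma₂ : ∀ n a r c → - n *ᶻ (a +ᶻ - r *ᶻ 1ℤ) +ᶻ c +ᶻ - 1ℤ *ᶻ (- n *ᶻ (a +ᶻ - r *ᶻ 0ℤ) +ᶻ c) ≡ n *ᶻ r
      lemma₂ = ℤ-Solver.solve-∀

  -- Supplies the second coefficient in T for `Comparison`. The kernel of multiplication by v is the
  -- whole group, so `cauchy` applies to G itself.
  ∃-order-3 : ∃[ t ] (t ≢ ε × 9 • t ≡ ε)
  ∃-order-3 = let t , t≢ε , 3t , _ = cauchy v prime[3] 3∣#κ in t , t≢ε , •-∣ 3 3 3t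
    where
    #κ≡v : #κ v ≡ v
    #κ≡v = ℤₚ.+-injective (trans (#-∑ (κ? v)) (trans (∑-cong λ x → 𝟙-yes (κ? v x) (order•≡ε x))
      (trans (∑-const v 1ℤ) (ℤₚ.*-identityʳ (+ v)))))
    3∣#κ : 3 ℕ∣.∣ #κ v
    3∣#κ = subst (3 ℕ∣.∣_) (sym (trans #κ≡v v≡9Q)) (ℕ∣.∣m⇒∣m*n Q (ℕ∣.divides 3 refl))

  module _ (4∣k : 4 ℕ∣.∣ k) (4∣n+1 : 4 ℕ∣.∣ n + 1) (3∣n : 3 ℕ∣.∣ n) where

    -- |D| = r (n + 1) with 4 ∣ n + 1, and the congruence between |D| and |D ∩ T| modulo k descends
    -- to 4.
    4∣#D∩T : 4 ℕ∣.∣ # D∩T?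
    4∣#D∩T = ≋0⇒∣ (≋-trans (≋-reflexive (sym χT≡#)) (≋-trans (≋-sym (≋-∣ 4∣k ∣D∣≋∣D∩T∣))
      (≋-trans (≋-reflexive ∑χ) (≋-trans (≋-* (≋-refl {a = R}) (∣⇒≋0 4∣n+1)) (≋-reflexive (ℤₚ.*-zeroʳ R))))))

    #D∩T≋R : + (# D∩T?) ≋ R [mod 3 ]
    #D∩T≋R = ≋-trans (≋-reflexive (sym χT≡#)) (∣D∩T∣≋r (∣⇒≋0 3∣n))

    case-0 : R ≋ 0ℤ [mod 3 ] → R *ᶻ R ≋ N *ᶻ R [mod k ]
    case-0 R≋0 = subst (λ z → z *ᶻ z ≋ N *ᶻ z [mod k ]) (ℤₚ.+-identityʳ R)
      (Comparison.R′²≋NR′ 0ℤ (λ {t} t∈T → 𝟙-no (t ∈? D) λ t∈D → #≡0⇒¬ D∩T? #≡0 (t∈D , t∈T))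
        (proj₁ (proj₂ ∃-order-3)) (proj₂ (proj₂ ∃-order-3)))
      where
      -- The candidates 0, 4 and 8 have residues 0, 1 and 2 modulo 3, so the residue of r leaves
      -- only 0.
      small : ∀ {a} → a ≤ 8 → 4 ℕ∣.∣ a → 3 ℕ∣.∣ a → a ≡ 0
      small a≤8 (ℕ∣.divides 0 refl) 3∣a = refl
      small a≤8 (ℕ∣.divides 1 refl) 3∣a = contradiction 3∣a (from-no (3 ℕ∣.∣? 4))
      small a≤8 (ℕ∣.divides 2 refl) 3∣a = contradiction 3∣a (from-no (3 ℕ∣.∣? 8))
      small a≤8 (ℕ∣.divides (suc (suc (suc q))) refl) 3∣a = contradiction a≤8 (ℕₚ.<⇒≱ (ℕₚ.m≤m+n 9 (3 + q * 4)))
      #≡0 : # D∩T? ≡ 0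
      #≡0 = small (ℕₚ.≤-trans (ℕₚ.m≤m+n _ _) #D∩T≤8) 4∣#D∩T (≋0⇒∣ (≋-trans #D∩T≋R R≋0))

    case-2 : R ≋ + 2 [mod 3 ] → (R +ᶻ 1ℤ) *ᶻ (R +ᶻ 1ℤ) ≋ N *ᶻ (R +ᶻ 1ℤ) [mod k ]
    case-2 R≋2 = Comparison.R′²≋NR′ 1ℤ χ-T (proj₁ (proj₂ ∃-order-3)) (proj₂ (proj₂ ∃-order-3))
      where
      -- Residue 2 leaves only a = 8, which exhausts the bound 8: every element of T other than `ε`
      -- lies in D.
      small : ∀ {a b} → a + b ≤ 8 → 4 ℕ∣.∣ a → + a ≋ + 2 [mod 3 ] → b ≡ 0
      small a≤8 (ℕ∣.divides 0 refl) a≋2 = contradiction (≋0⇒∣ (≋-sym a≋2)) (from-no (3 ℕ∣.∣? 2))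
      small a≤8 (ℕ∣.divides 1 refl) a≋2 =
        contradiction (≋0⇒∣ (≋-+-cancelʳ {a = + 2} {b = 0ℤ} (+ 2) a≋2)) (from-no (3 ℕ∣.∣? 2))
      small a≤8 (ℕ∣.divides 2 refl) a≋2 = ℕₚ.n≤0⇒n≡0 (ℕₚ.+-cancelˡ-≤ 8 _ _ a≤8)
      small a≤8 (ℕ∣.divides (suc (suc (suc q))) refl) a≋2 =
        contradiction (ℕₚ.≤-trans (ℕₚ.m≤m+n _ _) a≤8) (ℕₚ.<⇒≱ (ℕₚ.m≤m+n 9 (3 + q * 4)))
      #≡0 : # T∖D∖ε? ≡ 0
      #≡0 = small #D∩T≤8 4∣#D∩T (≋-trans #D∩T≋R R≋2)
      χ-T : ∀ {t} → 9 • t ≡ ε → χ t ≡ 1ℤ +ᶻ - 1ℤ *ᶻ δ ε t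
      χ-T {t} t∈T with ε ≟ t
      ... | yes refl = 𝟙-no (ε ∈? D) ε∉D
      ... | no ε≢t with t ∈? D
      ...   | yes _   = refl
      ...   | no t∉D = contradiction (t∈T , t∉D , λ e → ε≢t (sym e)) (#≡0⇒¬ T∖D∖ε? #≡0)

-- Arithmetic of the parameters, with p = 1 + 4 m.

-- p⁴ ≡ 1 modulo 4 (p - 1), because (p⁴ - 1) / (p - 1) = (p + 1) (p² + 1) is divisible by 4. The
-- polynomial `y` is the quotient (p⁴ - 1) / (4 (p - 1)).
^4-mod : ∀ m t → ∃[ z ] ((1 + 4 * m) ^ 4) ^ t ≡ 1 + 4 * (4 * m) * z
^4-mod m zero    = 0 , lemma m
  where
  lemma : ∀ m → 1 ≡ 1 + 4 * (4 * m) * 0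
  lemma = ℕ-Solver.solve-∀
^4-mod m (suc t) with z , e ← ^4-mod m t =
  y + z + 4 * (4 * m) * y * z , trans (cong ((1 + 4 * m) ^ 4 *_) e) (lemma m z)
  where
  y : ℕ
  y = 1 + 6 * m + 16 * m * m + 16 * m * m * m
  lemma : ∀ m z → (1 + 4 * m) * ((1 + 4 * m) * ((1 + 4 * m) * ((1 + 4 * m) * 1))) * (1 + 4 * (4 * m) * z)
    ≡ 1 + 4 * (4 * m) * ((1 + 6 * m + 16 * m * m + 16 * m * m * m) + z
      + 4 * (4 * m) * (1 + 6 * m + 16 * m * m + 16 * m * m * m) * z)
  lemma = ℕ-Solver.solve-∀

-- The 2-adic valuation of p ^ (2 s) − 1 exceeds that of p − 1 by exactly one; this is where s odd enters.
^2-odd-mod : ∀ m t → ∃[ j ] (1 + 4 * m) ^ (2 * (1 + t * 2)) ≡ 1 + 4 * m * (4 * j + 2)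
-- With s = 1 + 2 t the exponent is 2 + 4 t. Now p² - 1 = 4 m (4 m + 2), and the factor of exponent
-- 4 t, being 1 modulo 16 m, changes the cofactor 4 m + 2 only by a multiple of 4.
^2-odd-mod m t with z , e ← ^4-mod m t = m + z + z * (4 * m) * (4 * m + 2) , (begin
  (1 + 4 * m) ^ (2 * (1 + t * 2))               ≡⟨ cong ((1 + 4 * m) ^_) (exponent t) ⟩
  (1 + 4 * m) ^ (2 + 4 * t)                     ≡⟨ ℕₚ.^-distribˡ-+-* (1 + 4 * m) 2 (4 * t) ⟩
  (1 + 4 * m) ^ 2 * (1 + 4 * m) ^ (4 * t)       ≡⟨ cong ((1 + 4 * m) ^ 2 *_) (ℕₚ.^-*-assoc (1 + 4 * m) 4 t) ⟨
  (1 + 4 * m) ^ 2 * ((1 + 4 * m) ^ 4) ^ t       ≡⟨ cong ((1 + 4 * m) ^ 2 *_) e ⟩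
  (1 + 4 * m) ^ 2 * (1 + 4 * (4 * m) * z)       ≡⟨ lemma m z ⟩
  1 + 4 * m * (4 * (m + z + z * (4 * m) * (4 * m + 2)) + 2) ∎)
  where
  open ≡-Reasoning
  exponent : ∀ t → 2 * (1 + t * 2) ≡ 2 + 4 * t
  exponent = ℕ-Solver.solve-∀
  lemma : ∀ m z → (1 + 4 * m) * ((1 + 4 * m) * 1) * (1 + 4 * (4 * m) * z)
    ≡ 1 + 4 * m * (4 * (m + z + z * (4 * m) * (4 * m + 2)) + 2)
  lemma = ℕ-Solver.solve-∀

-- Cancelling 2 m leaves a product of two odd numbers equal to 2 z. In the application 2 m is (p -
-- 1) / 2 and 4 m is p - 1.
odd-product : ∀ m .{{_ : NonZero m}} w y z →
  (+ 2 *ᶻ + m *ᶻ (+ 2 *ᶻ w +ᶻ 1ℤ)) *ᶻ (+ 2 *ᶻ y +ᶻ 1ℤ) ≢ z *ᶻ + (4 * m)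
odd-product m w y z e = ℕₚ.even≢odd ℤ.∣ w′ ∣ 0 (trans (sym (ℤₚ.abs-* (+ 2) w′)) (cong ℤ.∣_∣ 2c≡1))
  where
  open ≡-Reasoning
  w′ : ℤ
  w′ = z -ᶻ (+ 2 *ᶻ w *ᶻ y +ᶻ w +ᶻ y)
  regroup : ∀ z m → z *ᶻ (+ 4 *ᶻ m) ≡ + 2 *ᶻ m *ᶻ (+ 2 *ᶻ z)
  regroup = ℤ-Solver.solve-∀
  expand : ∀ w y z → + 2 *ᶻ (z -ᶻ (+ 2 *ᶻ w *ᶻ y +ᶻ w +ᶻ y)) ≡ 1ℤ +ᶻ (+ 2 *ᶻ z -ᶻ (+ 2 *ᶻ w +ᶻ 1ℤ) *ᶻ
        (+ 2 *ᶻ y +ᶻ 1ℤ))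
  expand = ℤ-Solver.solve-∀
  2m≢0 : ℤ.NonZero (+ 2 *ᶻ + m)
  2m≢0 = ℤₚ.i*j≢0 (+ 2) (+ m)
  2c≡1 : + 2 *ᶻ w′ ≡ 1ℤ
  2c≡1 = begin
    + 2 *ᶻ w′                                                           ≡⟨ expand w y z ⟩
    1ℤ +ᶻ (+ 2 *ᶻ z -ᶻ (+ 2 *ᶻ w +ᶻ 1ℤ) *ᶻ (+ 2 *ᶻ y +ᶻ 1ℤ))
      ≡⟨ cong (λ x → 1ℤ +ᶻ (+ 2 *ᶻ z -ᶻ x)) cancelled ⟩
    1ℤ +ᶻ (+ 2 *ᶻ z -ᶻ + 2 *ᶻ z)                                       ≡⟨ cong (1ℤ +ᶻ_) (ℤₚ.+-inverseʳ (+ 2 *ᶻ z)) ⟩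
    1ℤ                                                                 ∎
    where
    cancelled : (+ 2 *ᶻ w +ᶻ 1ℤ) *ᶻ (+ 2 *ᶻ y +ᶻ 1ℤ) ≡ + 2 *ᶻ z
    cancelled = ℤₚ.*-cancelˡ-≡ (+ 2 *ᶻ + m) _ _ {{2m≢0}} (trans (sym (ℤₚ.*-assoc (+ 2 *ᶻ + m) _ _))
      (trans e (trans (cong (z *ᶻ_) (ℤₚ.pos-* 4 m)) (regroup z (+ m)))))

≋⇒- : ∀ {a b m} → a ≋ b [mod m ] → ∃[ z ] a -ᶻ b ≡ z *ᶻ + m
≋⇒- {b = b} {m} (by z refl) = z , lemma b (z *ᶻ + m)
  where
  lemma : ∀ b x → b +ᶻ x -ᶻ b ≡ x
  lemma = ℤ-Solver.solve-∀

-- The interface between the group theory and the arithmetic: each alternative selects `case-0` or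
-- `case-2` by the residue of r and refutes its conclusion.
Obstruction : ℕ → ℕ → ℕ → Set
Obstruction n k r =
    (+ r ≋ 0ℤ [mod 3 ] × ¬ (+ r *ᶻ + r ≋ + n *ᶻ + r [mod k ]))
  ⊎ (+ r ≋ + 2 [mod 3 ] × ¬ ((+ r +ᶻ 1ℤ) *ᶻ (+ r +ᶻ 1ℤ) ≋ + n *ᶻ (+ r +ᶻ 1ℤ) [mod k ]))

nonexistence : ∀ {v k e n r} (G : FinAbelianGroup v) (D : Subset v) →
  Prime (suc k) → Coprime 9 (suc k) → v ≡ 9 * suc k ^ suc e → v ≡ n * n → r + r ≢ n →
  4 ℕ∣.∣ k → 4 ℕ∣.∣ n + 1 → 3 ℕ∣.∣ n → Obstruction n k r →
  ¬ IsPDS G D (r * (n + 1)) (- + n +ᶻ + (r * r + 3 * r)) (+ (r * r + r))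
nonexistence {e = e} G D pr co v≡9Q v≡n² 2r≢n 4∣k 4∣n+1 3∣n (inj₁ (r≋0 , absurd)) pds =
  absurd (Projection.case-0 {m = e} G D pr co v≡9Q v≡n² 2r≢n pds 4∣k 4∣n+1 3∣n r≋0)
nonexistence {e = e} G D pr co v≡9Q v≡n² 2r≢n 4∣k 4∣n+1 3∣n (inj₂ (r≋2 , absurd)) pds =
  absurd (Projection.case-2 {m = e} G D pr co v≡9Q v≡n² 2r≢n pds 4∣k 4∣n+1 3∣n r≋2)

module Arithmetic (m : ℕ) .{{_ : NonZero m}} (j : ℕ) where
  private
    -- This is (q - 1) / 4 for q = p ^ (2 s). It is even, and the two values of r are 3 B and 2 + 3
    -- B.
    B = m * (4 * j + 2)

  q 3q : ℕ
  q = 1 + 4 * m * (4 * j + 2)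
  3q = 3 * q

  4∣3q+1 : 4 ℕ∣.∣ 3q + 1
  4∣3q+1 = ℕ∣.divides (1 + 3 * (m * (4 * j + 2))) (lemma m j)
    where
    lemma : ∀ m j → 3 * (1 + 4 * m * (4 * j + 2)) + 1 ≡ (1 + 3 * (m * (4 * j + 2))) * 4
    lemma = ℕ-Solver.solve-∀

  2*≢3q : ∀ r → r + r ≢ 3q
  2*≢3q r e = ℕₚ.even≢odd r (1 + 6 * m * (4 * j + 2)) (trans (lemma₁ r) (trans e (lemma₂ m j)))
    where
    lemma₁ : ∀ r → 2 * r ≡ r + r
    lemma₁ = ℕ-Solver.solve-∀
    lemma₂ : ∀ m j → 3 * (1 + 4 * m * (4 * j + 2)) ≡ suc (2 * (1 + 6 * m * (4 * j + 2)))
    lemma₂ = ℕ-Solver.solve-∀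

  pos : ∀ c → + (c * B) ≡ + c *ᶻ (+ m *ᶻ (+ 4 *ᶻ + j +ᶻ + 2))
  pos c = trans (ℤₚ.pos-* c B) (cong (+ c *ᶻ_) (trans (ℤₚ.pos-* m (4 * j + 2))
    (cong (λ x → + m *ᶻ (x +ᶻ + 2)) (ℤₚ.pos-* 4 j))))

  +3q : + 3q ≡ + 3 +ᶻ + 12 *ᶻ (+ m *ᶻ (+ 4 *ᶻ + j +ᶻ + 2))
  +3q = trans (cong +_ (lemma m j)) (cong (+ 3 +ᶻ_) (pos 12))
    where
    lemma : ∀ m j → 3 * (1 + 4 * m * (4 * j + 2)) ≡ 3 + 12 * (m * (4 * j + 2))
    lemma = ℕ-Solver.solve-∀

  module First {r : ℕ} (e : 4 * r + 3 ≡ 3q) where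
    r≡ : r ≡ 3 * B
    r≡ = ℕₚ.*-cancelˡ-≡ r (3 * B) 4 (ℕₚ.+-cancelʳ-≡ 3 (4 * r) (4 * (3 * B)) (trans e (lemma m j)))
      where
      lemma : ∀ m j → 3 * (1 + 4 * m * (4 * j + 2)) ≡ 4 * (3 * (m * (4 * j + 2))) + 3
      lemma = ℕ-Solver.solve-∀

    r≋0 : + r ≋ 0ℤ [mod 3 ]
    r≋0 = ∣⇒≋0 (subst (3 ℕ∣.∣_) (sym r≡) (ℕ∣.m∣m*n B))

    absurd : ¬ (+ r *ᶻ + r ≋ + 3q *ᶻ + r [mod 4 * m ])
    -- r = 3 B is 2 m times the odd number 3 (2 j + 1), and r - n = -9 B - 3 is odd; the two
    -- witnesses are the halves of these odd numbers.
    absurd h with z , eq ← ≋⇒- h = odd-product m (+ 3 *ᶻ + j +ᶻ 1ℤ) (- (+ 9 *ᶻ + m *ᶻ (+ 2 *ᶻ + j +ᶻ 1ℤ)) -ᶻ + 2) z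
      (trans (lemma (+ m) (+ j)) (trans (cong₂ (λ a b → a *ᶻ a -ᶻ b *ᶻ a) (sym (trans (cong +_ r≡) (pos 3)))
            (sym +3q)) eq))
      where
      lemma : ∀ m j → (+ 2 *ᶻ m *ᶻ (+ 2 *ᶻ (+ 3 *ᶻ j +ᶻ 1ℤ) +ᶻ 1ℤ)) *ᶻ (+ 2 *ᶻ (- (+ 9 *ᶻ m *ᶻ
            (+ 2 *ᶻ j +ᶻ 1ℤ)) -ᶻ + 2) +ᶻ 1ℤ)
        ≡ (+ 3 *ᶻ (m *ᶻ (+ 4 *ᶻ j +ᶻ + 2))) *ᶻ (+ 3 *ᶻ (m *ᶻ (+ 4 *ᶻ j +ᶻ + 2)))
          -ᶻ (+ 3 +ᶻ + 12 *ᶻ (m *ᶻ (+ 4 *ᶻ j +ᶻ + 2))) *ᶻ (+ 3 *ᶻ (m *ᶻ (+ 4 *ᶻ j +ᶻ + 2)))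
      lemma = ℤ-Solver.solve-∀

  module Second {r : ℕ} (e : 4 * r ≡ 3q + 5) where
    r≡ : r ≡ 2 + 3 * B
    r≡ = ℕₚ.*-cancelˡ-≡ r (2 + 3 * B) 4 (trans e (lemma m j))
      where
      lemma : ∀ m j → 3 * (1 + 4 * m * (4 * j + 2)) + 5 ≡ 4 * (2 + 3 * (m * (4 * j + 2)))
      lemma = ℕ-Solver.solve-∀

    r≋2 : + r ≋ + 2 [mod 3 ]
    r≋2 = ≋-trans (≋-reflexive (cong +_ r≡)) (≋-+ (≋-refl {a = + 2}) (∣⇒≋0 (ℕ∣.m∣m*n B)))

    absurd : ¬ ((+ r +ᶻ 1ℤ) *ᶻ (+ r +ᶻ 1ℤ) ≋ + 3q *ᶻ (+ r +ᶻ 1ℤ) [mod 4 * m ])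
    -- The roles are exchanged: for r′ = r + 1 = 3 B + 3, which is odd, r′ - n = -9 B is an odd
    -- multiple of 2 m. The minus sign is moved to the odd factor r′.
    absurd h with z , eq ← ≋⇒- h = odd-product m (+ 9 *ᶻ + j +ᶻ + 4) (- (+ 3 *ᶻ + m *ᶻ (+ 2 *ᶻ + j +ᶻ 1ℤ)) -ᶻ + 2) z
      (trans (lemma (+ m) (+ j)) (trans (cong₂ (λ a b → (a +ᶻ 1ℤ) *ᶻ (a +ᶻ 1ℤ) -ᶻ b *ᶻ (a +ᶻ 1ℤ)) (sym (trans
            (cong +_ r≡) (cong (+ 2 +ᶻ_) (pos 3)))) (sym +3q)) eq))
      where
      lemma : ∀ m j → (+ 2 *ᶻ m *ᶻ (+ 2 *ᶻ (+ 9 *ᶻ j +ᶻ + 4) +ᶻ 1ℤ)) *ᶻ (+ 2 *ᶻ (- (+ 3 *ᶻ m *ᶻ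
            (+ 2 *ᶻ j +ᶻ 1ℤ)) -ᶻ + 2) +ᶻ 1ℤ)
        ≡ (+ 2 +ᶻ + 3 *ᶻ (m *ᶻ (+ 4 *ᶻ j +ᶻ + 2)) +ᶻ 1ℤ) *ᶻ (+ 2 +ᶻ + 3 *ᶻ (m *ᶻ (+ 4 *ᶻ j +ᶻ + 2)) +ᶻ 1ℤ)
          -ᶻ (+ 3 +ᶻ + 12 *ᶻ (m *ᶻ (+ 4 *ᶻ j +ᶻ + 2))) *ᶻ (+ 2 +ᶻ + 3 *ᶻ (m *ᶻ (+ 4 *ᶻ j +ᶻ + 2)) +ᶻ 1ℤ)
      lemma = ℤ-Solver.solve-∀

  obstruction : ∀ {r} → 4 * r + 3 ≡ 3q ⊎ 4 * r ≡ 3q + 5 → Obstruction 3q (4 * m) r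
  obstruction (inj₁ e) = inj₁ (First.r≋0 e , First.absurd e)
  obstruction (inj₂ e) = inj₂ (Second.r≋2 e , Second.absurd e)

coprime-9 : ∀ m .{{_ : NonZero m}} → Prime (1 + 4 * m) → Coprime 9 (1 + 4 * m)
coprime-9 (suc m) pr = prime∤⇒coprime pr p∤9
  where
  p≰3 : ¬ 1 + 4 * suc m ℕ∣.∣ 3
  p≰3 d = ℕₚ.<⇒≱ (subst (4 ≤_) (sym (lemma m)) (ℕₚ.m≤m+n 4 (1 + 4 * m))) (ℕ∣.∣⇒≤ d)
    where
    lemma : ∀ m → 1 + 4 * suc m ≡ 4 + (1 + 4 * m)
    lemma = ℕ-Solver.solve-∀
  p∤9 : ¬ 1 + 4 * suc m ℕ∣.∣ 9
  p∤9 d with euclidsLemma 3 3 pr d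
  ... | inj₁ d′ = p≰3 d′
  ... | inj₂ d′ = p≰3 d′

theorem7 : (p s r : ℕ) → Prime p → p % 4 ≡ 1 → s % 2 ≡ 1 →
    (4 * r + 3 ≡ 3 * p ^ (2 * s) ⊎ 4 * r ≡ 3 * p ^ (2 * s) + 5) →
    (G : FinAbelianGroup (9 * p ^ (4 * s))) → (D : Subset (9 * p ^ (4 * s))) →
    ¬ IsPDS G D (r * (3 * p ^ (2 * s) + 1))
    ((- (+ (3 * p ^ (2 * s)))) +ᶻ (+ (r * r + 3 * r)))
    (+ (r * r + r))
theorem7 zero    s r pr _ _ = contradiction pr ¬prime[0]
theorem7 (suc k) s r pr p%4≡1 s%2≡1 cases G D = nonexistence {e = 3 + 4 * (t * 2)} G D pr
  (subst (λ x → Coprime 9 (suc x)) (sym k≡) (coprime-9 h (subst (λ x → Prime (suc x)) k≡ pr)))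
  (cong (λ x → 9 * suc k ^ x) 4s≡) v≡n²
  (subst (r + r ≢_) (sym 3p^2s≡3q) (2*≢3q r))
  (subst (4 ℕ∣.∣_) (sym k≡) (ℕ∣.m∣m*n h)) (subst (λ x → 4 ℕ∣.∣ x + 1) (sym 3p^2s≡3q) 4∣3q+1) (ℕ∣.m∣m*n
        (suc k ^ (2 * s)))
  (subst (λ x → Obstruction x k r) (sym 3p^2s≡3q) (subst (λ x → Obstruction 3q x r) (sym k≡)
    (obstruction (subst (λ x → 4 * r + 3 ≡ x ⊎ 4 * r ≡ x + 5) 3p^2s≡3q cases))))
  where
  h t : ℕ
  h = suc k / 4
  t = s / 2
  k≡ : k ≡ 4 * h
  k≡ = ℕₚ.suc-injective (trans (m≡m%n+[m/n]*n (suc k) 4) (cong₂ _+_ p%4≡1 (ℕₚ.*-comm h 4)))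
  s≡ : s ≡ 1 + t * 2
  s≡ = trans (m≡m%n+[m/n]*n s 2) (cong (_+ t * 2) s%2≡1)
  instance
    h≢0 : NonZero h
    h≢0 = ≢-nonZero λ e → ¬prime[1] (subst Prime (cong suc (trans k≡ (cong (4 *_) e))) pr)
  j : ℕ
  j = proj₁ (^2-odd-mod h t)
  open Arithmetic h j
  3p^2s≡3q : 3 * suc k ^ (2 * s) ≡ 3q
  3p^2s≡3q = cong (3 *_) (trans (cong₂ (λ x y → suc x ^ (2 * y)) k≡ s≡) (proj₂ (^2-odd-mod h t)))
  -- The exponent is exhibited as a successor because `nonexistence` takes v in the form 9 times p
  -- to the power `suc e`.
  4s≡ : 4 * s ≡ suc (3 + 4 * (t * 2))
  4s≡ = trans (cong (4 *_) s≡) (exponent t)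
    where
    exponent : ∀ t → 4 * (1 + t * 2) ≡ 4 + 4 * (t * 2)
    exponent = ℕ-Solver.solve-∀
  v≡n² : 9 * suc k ^ (4 * s) ≡ 3 * suc k ^ (2 * s) * (3 * suc k ^ (2 * s))
  v≡n² = trans (cong (λ x → 9 * suc k ^ x) (exponent s)) (trans (cong (9 *_)
    (ℕₚ.^-distribˡ-+-* (suc k) (2 * s) (2 * s))) (lemma (suc k ^ (2 * s))))
    where
    exponent : ∀ s → 4 * s ≡ 2 * s + 2 * s
    exponent = ℕ-Solver.solve-∀
    lemma : ∀ q → 9 * (q * q) ≡ 3 * q * (3 * q)
    lemma = ℕ-Solver.solve-∀
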